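{- Let $r$ and $d$ be positive integers, let $\operatorname{Tv}(d,r)=(d+1)(r-1)+1$, and let $S$ be a set of $n>\operatorname{Tv}(d,r)$ points in $\mathbb{R}^d$. Then every vertex $v$ of the Tverberg $r$-partition graph $G_T[S,r]$ satisfies \[\big(n+1-\operatorname{Tv}(d,r)\big)(r-1)\le \deg(v)\le n(r-1).\]
   Context: A partition of a finite set $S$ into $r$ parts is a collection of $r$ nonempty pairwise disjoint subsets $P_1,\dots,P_r$ (unordered) whose union is $S$. For a finite $S\subset\mathbb{R}^d$, a Tverberg partition of $S$ into $r$ parts is a partition $P_1,\dots,P_r$ of $S$ into $r$ parts with $\bigcap_{j=1}^r\operatorname{conv}(P_j)\neq\emptyset$. For two partitions $P,P'$ of $S$, the partition distance $D(P,P')$ is the minimum number of elements of $S$ that must be removed so that $P$ and $P'$ restricted to the remaining elements coincide. The Tverberg $r$-partition graph $G_T[S,r]$ has as vertices all Tverberg partitions of $S$ into $r$ parts, with an edge between $P$ and $P'$ if and only if $D(P,P')=1$. -}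

module Defs where

open import Algebra.Bundles using (RawMonoid)
import Algebra.Definitions.RawMonoid as RawMonoidDefs
open import Data.Fin.Base using (Fin)
open import Data.Fin.Subset using (Subset; _∈_; _∉_; _∩_; ∁; ⊥; Nonempty; Empty; ∣_∣)
open import Data.Fin.Subset.Properties using (∣⊥∣≡0)
open import Data.Nat.Base as ℕ using (ℕ)
import Data.Nat.Properties as ℕₚ
open import Data.Product.Base using (Σ; ∃; ∃-syntax; _×_; _,_; proj₁)
open import Data.Rational.Base as ℚ using (ℚ; 0ℚ; 1ℚ; ½)
import Data.Rational.Properties as ℚₚ
open import Data.Rational.Solver using (module +-*-Solver)
open import Data.Vec.Functional using (Vector)
open import Function.Bundles using (Bijection; _⇔_; mk⇔; Equivalence)
import Function.Properties.Equivalence as ⇔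
open import Level using (0ℓ)
open import Relation.Binary.Bundles using (Setoid)
import Relation.Binary.Construct.On as On
open import Relation.Binary.Core using (Rel)
open import Relation.Binary.Definitions using (Symmetric; Irreflexive; _Respects₂_)
open import Relation.Binary.PropositionalEquality
  using (_≡_; _≢_; refl; sym; trans; cong; subst; setoid)
open import Relation.Nullary.Negation using (contradiction)

------------------------------------------------------------------------
-- Real numbers: Cauchy sequences of rationals, identified when their
-- difference tends to zero.

IsCauchy : (ℕ → ℚ) → Set
IsCauchy a = ∀ ε → 0ℚ ℚ.< ε →
  ∃[ N ] ∀ m n → N ℕ.≤ m → N ℕ.≤ n → ℚ.∣ a m ℚ.- a n ∣ ℚ.≤ ε

record ℝ : Set where
  constructor mkℝ
  field
    seq    : ℕ → ℚ
    cauchy : IsCauchy seq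

open ℝ

infix 4 _≈_ _≤_

_≈_ : Rel ℝ 0ℓ
x ≈ y = ∀ ε → 0ℚ ℚ.< ε →
  ∃[ N ] ∀ n → N ℕ.≤ n → ℚ.∣ seq x n ℚ.- seq y n ∣ ℚ.≤ ε

_≤_ : Rel ℝ 0ℓ
x ≤ y = ∀ ε → 0ℚ ℚ.< ε →
  ∃[ N ] ∀ n → N ℕ.≤ n → seq x n ℚ.≤ seq y n ℚ.+ ε

fromℚ : ℚ → ℝ
fromℚ q = mkℝ (λ _ → q) λ ε 0<ε → 0 , λ _ _ _ _ →
  subst (ℚ._≤ ε) (sym (cong ℚ.∣_∣ (ℚₚ.+-inverseʳ q))) (ℚₚ.<⇒≤ 0<ε)

0ℝ 1ℝ : ℝ
0ℝ = fromℚ 0ℚ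
1ℝ = fromℚ 1ℚ

open +-*-Solver using (solve; _:+_; _:*_; _:-_; _:=_; con)

half-positive : ∀ {ε} → 0ℚ ℚ.< ε → 0ℚ ℚ.< ½ ℚ.* ε
half-positive {ε} 0<ε = ℚₚ.positive⁻¹ _ ⦃ ℚₚ.pos*pos⇒pos ½ ε ⦃ ℚ.positive 0<ε ⦄ ⦄

halves : ∀ ε → ½ ℚ.* ε ℚ.+ ½ ℚ.* ε ≡ ε
halves = solve 1 (λ ε → con ½ :* ε :+ con ½ :* ε := ε) refl

split-sum : ∀ p q r s → (p ℚ.+ q) ℚ.- (r ℚ.+ s) ≡ (p ℚ.- r) ℚ.+ (q ℚ.- s)
split-sum = solve 4 (λ p q r s → (p :+ q) :- (r :+ s) := (p :- r) :+ (q :- s)) refl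

split-point : ∀ p q → p ≡ (p ℚ.- q) ℚ.+ q
split-point = solve 2 (λ p q → p := (p :- q) :+ q) refl

split-product : ∀ p q r s → p ℚ.* q ℚ.- r ℚ.* s ≡ p ℚ.* (q ℚ.- s) ℚ.+ (p ℚ.- r) ℚ.* s
split-product = solve 4 (λ p q r s → p :* q :- r :* s := p :* (q :- s) :+ (p :- r) :* s) refl

factor : ∀ p q i e → p ℚ.* (i ℚ.* e) ℚ.+ (i ℚ.* e) ℚ.* q ≡ (p ℚ.+ q) ℚ.* i ℚ.* e
factor = solve 4 (λ p q i e → p :* (i :* e) :+ (i :* e) :* q := (p :+ q) :* i :* e) refl

-- Abstract because unfolding these two proofs makes type checking slow.
abstract
  +-cauchy : ∀ a b → IsCauchy a → IsCauchy b → IsCauchy (λ n → a n ℚ.+ b n)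
  +-cauchy a b ca cb ε 0<ε
    with ca (½ ℚ.* ε) (half-positive 0<ε) | cb (½ ℚ.* ε) (half-positive 0<ε)
  ... | M , close-a | N , close-b = M ℕ.⊔ N , λ m n m≥ n≥ → begin
    ℚ.∣ (a m ℚ.+ b m) ℚ.- (a n ℚ.+ b n) ∣
      ≡⟨ cong ℚ.∣_∣ (split-sum (a m) (b m) (a n) (b n)) ⟩
    ℚ.∣ (a m ℚ.- a n) ℚ.+ (b m ℚ.- b n) ∣
      ≤⟨ ℚₚ.∣p+q∣≤∣p∣+∣q∣ (a m ℚ.- a n) (b m ℚ.- b n) ⟩
    ℚ.∣ a m ℚ.- a n ∣ ℚ.+ ℚ.∣ b m ℚ.- b n ∣
      ≤⟨ ℚₚ.+-mono-≤
           (close-a m n (ℕₚ.m⊔n≤o⇒m≤o M N m≥) (ℕₚ.m⊔n≤o⇒m≤o M N n≥))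
           (close-b m n (ℕₚ.m⊔n≤o⇒n≤o M N m≥) (ℕₚ.m⊔n≤o⇒n≤o M N n≥)) ⟩
    ½ ℚ.* ε ℚ.+ ½ ℚ.* ε
      ≡⟨ halves ε ⟩
    ε ∎
    where open ℚₚ.≤-Reasoning

0<1ℚ : 0ℚ ℚ.< 1ℚ
0<1ℚ = ℚₚ.positive⁻¹ 1ℚ

eventually-bounded : ∀ a → IsCauchy a →
  ∃[ B ] ∃[ N ] ℚ.Positive B × (∀ n → N ℕ.≤ n → ℚ.∣ a n ∣ ℚ.≤ B)
eventually-bounded a ca with ca 1ℚ 0<1ℚ
... | N , close = 1ℚ ℚ.+ ℚ.∣ a N ∣ , N , B>0 , λ n n≥ → begin
  ℚ.∣ a n ∣
    ≡⟨ cong ℚ.∣_∣ (split-point (a n) (a N)) ⟩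
  ℚ.∣ (a n ℚ.- a N) ℚ.+ a N ∣
    ≤⟨ ℚₚ.∣p+q∣≤∣p∣+∣q∣ (a n ℚ.- a N) (a N) ⟩
  ℚ.∣ a n ℚ.- a N ∣ ℚ.+ ℚ.∣ a N ∣
    ≤⟨ ℚₚ.+-monoˡ-≤ ℚ.∣ a N ∣ (close n N n≥ ℕₚ.≤-refl) ⟩
  1ℚ ℚ.+ ℚ.∣ a N ∣ ∎
  where
  open ℚₚ.≤-Reasoning
  B>0 : ℚ.Positive (1ℚ ℚ.+ ℚ.∣ a N ∣)
  B>0 = ℚₚ.pos+nonNeg⇒pos 1ℚ ℚ.∣ a N ∣ ⦃ ℚₚ.∣-∣-nonNeg (a N) ⦄

*-mono-≤-abs : ∀ p q {b c} → ℚ.∣ p ∣ ℚ.≤ b → ℚ.∣ q ∣ ℚ.≤ c → ℚ.∣ p ℚ.* q ∣ ℚ.≤ b ℚ.* c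
*-mono-≤-abs p q {b} {c} p≤b q≤c = begin
  ℚ.∣ p ℚ.* q ∣        ≡⟨ ℚₚ.∣p*q∣≡∣p∣*∣q∣ p q ⟩
  ℚ.∣ p ∣ ℚ.* ℚ.∣ q ∣  ≤⟨ ℚₚ.*-monoʳ-≤-nonNeg ℚ.∣ q ∣ ⦃ ℚₚ.∣-∣-nonNeg q ⦄ p≤b ⟩
  b ℚ.* ℚ.∣ q ∣
    ≤⟨ ℚₚ.*-monoˡ-≤-nonNeg b ⦃ ℚ.nonNegative (ℚₚ.≤-trans (ℚₚ.0≤∣p∣ p) p≤b) ⦄ q≤c ⟩
  b ℚ.* c ∎
  where open ℚₚ.≤-Reasoning

share : ∀ A B {ε} → ℚ.Positive A → ℚ.Positive B → 0ℚ ℚ.< ε →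
        ∃[ δ ] 0ℚ ℚ.< δ × A ℚ.* δ ℚ.+ δ ℚ.* B ≡ ε
share A B {ε} A>0 B>0 0<ε =
    (ℚ.1/ C) ℚ.* ε
  , ℚₚ.positive⁻¹ _ ⦃ ℚₚ.pos*pos⇒pos (ℚ.1/ C) ⦃ ℚₚ.1/pos⇒pos C ⦄ ε ⦃ ℚ.positive 0<ε ⦄ ⦄
  , trans (factor A B (ℚ.1/ C) ε)
      (trans (cong (ℚ._* ε) (ℚₚ.*-inverseʳ C)) (ℚₚ.*-identityˡ ε))
  where
  C = A ℚ.+ B
  instance
    C>0 : ℚ.Positive C
    C>0 = ℚₚ.pos+pos⇒pos A ⦃ A>0 ⦄ B ⦃ B>0 ⦄
    C≢0 : ℚ.NonZero C
    C≢0 = ℚₚ.pos⇒nonZero C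

product-close : ∀ p q r s {A B δ ε} → A ℚ.* δ ℚ.+ δ ℚ.* B ≡ ε →
  ℚ.∣ p ∣ ℚ.≤ A → ℚ.∣ s ∣ ℚ.≤ B → ℚ.∣ p ℚ.- r ∣ ℚ.≤ δ → ℚ.∣ q ℚ.- s ∣ ℚ.≤ δ →
  ℚ.∣ p ℚ.* q ℚ.- r ℚ.* s ∣ ℚ.≤ ε
product-close p q r s {A} {B} {δ} {ε} eq p≤A s≤B p≈r q≈s = begin
  ℚ.∣ p ℚ.* q ℚ.- r ℚ.* s ∣
    ≡⟨ cong ℚ.∣_∣ (split-product p q r s) ⟩
  ℚ.∣ p ℚ.* (q ℚ.- s) ℚ.+ (p ℚ.- r) ℚ.* s ∣
    ≤⟨ ℚₚ.∣p+q∣≤∣p∣+∣q∣ (p ℚ.* (q ℚ.- s)) ((p ℚ.- r) ℚ.* s) ⟩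
  ℚ.∣ p ℚ.* (q ℚ.- s) ∣ ℚ.+ ℚ.∣ (p ℚ.- r) ℚ.* s ∣
    ≤⟨ ℚₚ.+-mono-≤ (*-mono-≤-abs p (q ℚ.- s) p≤A q≈s) (*-mono-≤-abs (p ℚ.- r) s p≈r s≤B) ⟩
  A ℚ.* δ ℚ.+ δ ℚ.* B
    ≡⟨ eq ⟩
  ε ∎
  where open ℚₚ.≤-Reasoning

abstract
  *-cauchy : ∀ a b → IsCauchy a → IsCauchy b → IsCauchy (λ n → a n ℚ.* b n)
  *-cauchy a b ca cb ε 0<ε =
    let A , K , A>0 , a≤A = eventually-bounded a ca
        B , L , B>0 , b≤B = eventually-bounded b cb
        δ , 0<δ , eq      = share A B A>0 B>0 0<ε
        M , close-a       = ca δ 0<δ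
        N , close-b       = cb δ 0<δ
        left : ∀ {k} → (K ℕ.⊔ L) ℕ.⊔ (M ℕ.⊔ N) ℕ.≤ k → K ℕ.⊔ L ℕ.≤ k
        left  = ℕₚ.m⊔n≤o⇒m≤o (K ℕ.⊔ L) (M ℕ.⊔ N)
        right : ∀ {k} → (K ℕ.⊔ L) ℕ.⊔ (M ℕ.⊔ N) ℕ.≤ k → M ℕ.⊔ N ℕ.≤ k
        right = ℕₚ.m⊔n≤o⇒n≤o (K ℕ.⊔ L) (M ℕ.⊔ N)
    in (K ℕ.⊔ L) ℕ.⊔ (M ℕ.⊔ N) , λ m n m≥ n≥ →
      product-close (a m) (b m) (a n) (b n) eq
        (a≤A m (ℕₚ.m⊔n≤o⇒m≤o K L (left m≥)))
        (b≤B n (ℕₚ.m⊔n≤o⇒n≤o K L (left n≥)))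
        (close-a m n (ℕₚ.m⊔n≤o⇒m≤o M N (right m≥)) (ℕₚ.m⊔n≤o⇒m≤o M N (right n≥)))
        (close-b m n (ℕₚ.m⊔n≤o⇒n≤o M N (right m≥)) (ℕₚ.m⊔n≤o⇒n≤o M N (right n≥)))

infixl 6 _+_
infixl 7 _*_

_+_ : ℝ → ℝ → ℝ
x + y = mkℝ (λ n → seq x n ℚ.+ seq y n) (+-cauchy (seq x) (seq y) (cauchy x) (cauchy y))

_*_ : ℝ → ℝ → ℝ
x * y = mkℝ (λ n → seq x n ℚ.* seq y n) (*-cauchy (seq x) (seq y) (cauchy x) (cauchy y))

+-0-rawMonoid : RawMonoid 0ℓ 0ℓ
+-0-rawMonoid = record { Carrier = ℝ ; _≈_ = _≈_ ; _∙_ = _+_ ; ε = 0ℝ }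

open RawMonoidDefs +-0-rawMonoid public using (sum)

------------------------------------------------------------------------
-- Points of ℝ^d, and n-element point sets given by an enumeration
-- without repetition. Subsets of such a set are subsets of its index
-- set Fin n.

ℝ^ : ℕ → Set
ℝ^ d = Vector ℝ d

record PointSet (d n : ℕ) : Set where
  field
    point    : Fin n → ℝ^ d
    distinct : ∀ {i j} → (∀ k → point i k ≈ point j k) → i ≡ j

record _∈conv[_]_ {d n} (y : ℝ^ d) (S : PointSet d n) (A : Subset n) : Set where
  open PointSet S
  field
    weight      : Fin n → ℝ
    nonNegative : ∀ i → 0ℝ ≤ weight i
    supported   : ∀ {i} → i ∉ A → weight i ≈ 0ℝ
    total       : sum weight ≈ 1ℝ
    combination : ∀ k → sum (λ i → weight i * point i k) ≈ y k

------------------------------------------------------------------------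
-- Partitions. The labelling of the parts by Fin r is forgotten by _≋_.

record Partition (n r : ℕ) : Set where
  field
    part     : Fin r → Subset n
    nonempty : ∀ j → Nonempty (part j)
    disjoint : ∀ {i j} → i ≢ j → Empty (part i ∩ part j)
    covers   : ∀ s → ∃[ j ] s ∈ part j

open Partition

_IsPartOf_ : ∀ {n r} → Subset n → Partition n r → Set
A IsPartOf P = ∃[ j ] part P j ≡ A

infix 4 _≋_

_≋_ : ∀ {n r} → Rel (Partition n r) 0ℓ
P ≋ Q = ∀ A → A IsPartOf P ⇔ A IsPartOf Q

_IsPartOf_↾_ : ∀ {n r} → Subset n → Partition n r → Subset n → Set
A IsPartOf P ↾ T = Nonempty A × ∃[ j ] part P j ∩ T ≡ A

CoincideOn : ∀ {n r} → Subset n → Rel (Partition n r) 0ℓ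
CoincideOn T P Q = ∀ A → A IsPartOf P ↾ T ⇔ A IsPartOf Q ↾ T

-- D[ P , Q ]≡ k states D(P, Q) = k.
D[_,_]≡_ : ∀ {n r} → Partition n r → Partition n r → ℕ → Set
D[ P , Q ]≡ k =
  (∃[ R ] ∣ R ∣ ≡ k × CoincideOn (∁ R) P Q) ×
  (∀ R → CoincideOn (∁ R) P Q → k ℕ.≤ ∣ R ∣)

IsTverberg : ∀ {d n r} → PointSet d n → Partition n r → Set
IsTverberg {d} S P = ∃[ y ] ∀ j → y ∈conv[ S ] part P j

------------------------------------------------------------------------
-- Simple graphs, on a vertex set with a specified equality.

record Graph : Set₁ where
  infix 4 _~_
  field
    vertices    : Setoid 0ℓ 0ℓ
  open Setoid vertices public renaming (Carrier to Vertex; _≈_ to _≈ᵥ_) using ()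
  field
    _~_         : Rel Vertex 0ℓ
    ~-resp-≈    : _~_ Respects₂ _≈ᵥ_
    symmetric   : Symmetric _~_
    irreflexive : Irreflexive _≈ᵥ_ _~_

  neighbours : Vertex → Setoid 0ℓ 0ℓ
  neighbours v = On.setoid {B = Σ Vertex (v ~_)} vertices proj₁

  -- HasDegree v k states deg(v) = k.
  HasDegree : Vertex → ℕ → Set
  HasDegree v k = Bijection (setoid (Fin k)) (neighbours v)

≋⇒CoincideOn : ∀ {n r} T {P Q : Partition n r} → P ≋ Q → CoincideOn T P Q
≋⇒CoincideOn T {P} {Q} P≋Q A = mk⇔
  (transport P Q (λ B → Equivalence.to (P≋Q B)))
  (transport Q P (λ B → Equivalence.from (P≋Q B)))
  where
  transport : ∀ P Q → (∀ B → B IsPartOf P → B IsPartOf Q) →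
              A IsPartOf P ↾ T → A IsPartOf Q ↾ T
  transport P Q f (ne , j , eq) with f (part P j) (j , refl)
  ... | j′ , eq′ = ne , j′ , trans (cong (_∩ T) eq′) eq

D-resp : ∀ {n r k} {P P′ Q Q′ : Partition n r} →
         P ≋ P′ → Q ≋ Q′ → D[ P , Q ]≡ k → D[ P′ , Q′ ]≡ k
D-resp {P = P} {P′} {Q} {Q′} P≋ Q≋ ((R , size , c) , least) =
    (R , size , λ A → ⇔.trans (⇔.sym (p A)) (⇔.trans (c A) (q A)))
  , λ R′ c′ → least R′ λ A → ⇔.trans (≋⇒CoincideOn (∁ R′) {P} {P′} P≋ A)
      (⇔.trans (c′ A) (⇔.sym (≋⇒CoincideOn (∁ R′) {Q} {Q′} Q≋ A)))
  where
  p = ≋⇒CoincideOn (∁ R) {P} {P′} P≋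
  q = ≋⇒CoincideOn (∁ R) {Q} {Q′} Q≋

D-sym : ∀ {n r k} (P Q : Partition n r) → D[ P , Q ]≡ k → D[ Q , P ]≡ k
D-sym P Q ((R , size , c) , least) =
  (R , size , λ A → ⇔.sym (c A)) , λ R′ c′ → least R′ λ A → ⇔.sym (c′ A)

D-irrefl : ∀ {n r} (P Q : Partition n r) → P ≋ Q → D[ P , Q ]≡ 1 → ∀ {ℓ} {X : Set ℓ} → X
D-irrefl {n} P Q P≋Q (_ , least) =
  contradiction (subst (1 ℕ.≤_) (∣⊥∣≡0 n) (least ⊥ (≋⇒CoincideOn (∁ ⊥) {P} {Q} P≋Q))) λ ()

partitions : ℕ → ℕ → Setoid 0ℓ 0ℓ
partitions n r = record
  { Carrier       = Partition n r
  ; _≈_           = _≋_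
  ; isEquivalence = record
    { refl  = λ _ → ⇔.refl
    ; sym   = λ p A → ⇔.sym (p A)
    ; trans = λ p q A → ⇔.trans (p A) (q A)
    }
  }

TverbergPartition : ∀ {d n} → PointSet d n → ℕ → Set
TverbergPartition {n = n} S r = Σ (Partition n r) (IsTverberg S)

G-T[_,_] : ∀ {d n} → PointSet d n → ℕ → Graph
G-T[_,_] {n = n} S r = record
  { vertices    = On.setoid {B = TverbergPartition S r} (partitions n r) proj₁
  ; _~_         = λ (P , _) (Q , _) → D[ P , Q ]≡ 1
  ; ~-resp-≈    =
      (λ {(P , _)} {(Q , _)} {(Q′ , _)} Q≋ →
        D-resp {P = P} {P} {Q} {Q′} (λ _ → ⇔.refl) Q≋)
    , (λ {(Q , _)} {(P , _)} {(P′ , _)} P≋ →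
        D-resp {P = P} {P′} {Q} {Q} P≋ (λ _ → ⇔.refl))
  ; symmetric   = λ {(P , _)} {(Q , _)} → D-sym P Q
  ; irreflexive = λ {(P , _)} {(Q , _)} P≋Q d → D-irrefl P Q P≋Q d
  }

-- For r ≥ 1, as always here, truncated subtraction is exact.
Tv : ℕ → ℕ → ℕ
Tv d r = (d ℕ.+ 1) ℕ.* (r ℕ.∸ 1) ℕ.+ 1

{-# OPTIONS --safe #-}

-- The neighbours of a partition P are obtained by moving one point s out of a part that does not
-- consist of s alone into one of the r − 1 other parts, and different moves give different
-- partitions. This gives the upper bound. A Tverberg point of P is the same as a nonzero vector
-- w ≥ 0 in the kernel of a matrix with m = (d + 1)(r − 1) rows and one column for each point of S:
-- the rows say that all parts have the same total weight and the same weighted sum. If some such w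
-- vanishes at s, then s may be moved to any other part, so for the lower bound it suffices that at
-- most m points are essential, meaning that no such w vanishes there. If the set C of essential
-- points had more than m elements, then, as n ≥ m + 2, there would be a nonzero kernel vector u
-- supported on C and at most one further point x, with u c = 0 for some c in C, and with u x ≤ 0.
-- If u ≤ 0, then − u shows that c is not essential. Otherwise subtract from w the largest multiple of
-- u that keeps it nonnegative: the result is positive at c and vanishes at a point of C.

module Submission where

open import Defs using (PointSet; Graph; G-T[_,_]; Tv)
open import Defs using
  (ℝ; mkℝ; IsCauchy; 0ℝ; 1ℝ; half-positive; halves; product-close; share; eventually-bounded; 0<1ℚ
  ; ℝ^; _∈conv[_]_; Partition; IsTverberg; _≋_; CoincideOn; D[_,_]≡_; D-irrefl
  ; _IsPartOf_; _IsPartOf_↾_; ≋⇒CoincideOn)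
  renaming (_+_ to infixl 6 _+ᴿ_; _*_ to infixl 7 _*ᴿ_; _≈_ to _≈ᴿ_; _≤_ to _≤ᴿ_)
open import Algebra.Bundles using (CommutativeRing)
import Algebra.Consequences.Setoid
import Algebra.Properties.AbelianGroup as AbelianGroupProperties
import Algebra.Properties.Ring as RingProperties
import Algebra.Properties.Semiring.Sum as SemiringSum
open import Algebra.Structures using (IsCommutativeRing)
open import Axiom.ExcludedMiddle using (ExcludedMiddle)
open import Data.Bool.Base using (if_then_else_)
open import Data.Fin.Base using (Fin; zero; suc; punchIn; punchOut; remQuot; combine)
open import Data.Fin.Properties
  using (_≟_; any?; suc-injective; injective⇒≤; punchInᵢ≢i; punchIn-punchOut; punchIn-injective
        ; punchOut-injective; remQuot-combine; combine-remQuot)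
open import Data.Fin.Subset
  using (Subset; inside; outside; _∈_; _∉_; _∩_; _∪_; ∁; ⊤; _-_; ⁅_⁆; ∣_∣; Nonempty)
open import Data.Fin.Subset.Properties
  using (_∈?_; nonempty?; Empty-unique; ∣p∣≤n; ∣⊥∣≡0; ∣⊤∣≡n; ∈⊤; ⊆⊤; ⊆-antisym; p⊂q⇒∣p∣<∣q∣; p─⊥≡p; p─q⊆p
        ; x∈⁅x⁆; x∈⁅y⁆⇒x≡y; ∣⁅x⁆∣≡1; x∈p∪q⁻; p⊆p∪q; q⊆p∪q; x∈p∩q⁺; x∈p∩q⁻; x∈p∧x≢y⇒x∈p-y; x∈p⇒∣p-x∣<∣p∣
        ; x∈∁p⇒x∉p; x∉p⇒x∈∁p; ∣∁p∣≡n∸∣p∣)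
open import Data.Nat.Base using (ℕ; _+_; _*_; _∸_; _<_; _≤_)
open import Data.Nat.Base as ℕ using (zero; suc; z≤n; s≤s)
import Data.Nat.Properties as ℕₚ
open import Data.Product.Base using (∃-syntax; _×_)
open import Data.Product.Base using (Σ; ∃; _,_; proj₁; proj₂; uncurry)
open import Data.Rational.Base as ℚ using (ℚ; 0ℚ; 1ℚ; ½)
import Data.Rational.Properties as ℚₚ
open import Data.Rational.Solver using (module +-*-Solver)
open import Data.Sum.Base using (_⊎_; inj₁; inj₂; [_,_]′)
open import Data.Unit.Base using (tt) renaming (⊤ to Unit)
open import Data.Vec.Base using ([]; _∷_; here; there; tabulate)
open import Data.Vec.Functional as Vector using (Vector)
open import Data.Vec.Properties using (lookup⇒[]=; []=⇒lookup; lookup∘tabulate)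
open import Function.Base using (_∘_; id)
open import Function.Bundles using (_⇔_; mk⇔; Equivalence)
open import Function.Definitions using (Injective)
import Function.Properties.Equivalence as ⇔
open import Level using (0ℓ)
import Relation.Binary.Reasoning.Setoid as SetoidReasoning
open import Relation.Binary.PropositionalEquality
  using (_≡_; _≢_; refl; sym; trans; cong; cong₂; subst)
open import Relation.Binary.Bundles using (Setoid)
open import Relation.Nullary using (¬_; Dec; yes; no; does)
open import Relation.Nullary.Decidable using (decidable-stable; dec-true; dec-false; ¬?; _×-dec_)
open import Relation.Nullary.Negation using (contradiction)

open +-*-Solver using (solve; _:+_; _:*_; _:-_; :-_; _:=_; con)
open Equivalence using (to; from)
open ℝ using (seq; cauchy)

-- The ordered field of Cauchy reals

-- By definition `x ≈ᴿ y` says that the difference of the two sequences is `Null`, so compatibility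
-- of `_≃_` with the operations reduces to closure properties of null sequences.
Null : (ℕ → ℚ) → Set
Null a = ∀ ε → 0ℚ ℚ.< ε → ∃[ N ] ∀ n → N ℕ.≤ n → ℚ.∣ a n ∣ ℚ.≤ ε

null-resp : ∀ a b → (∀ n → a n ≡ b n) → Null a → Null b
null-resp a b a≗b na ε 0<ε with na ε 0<ε
... | N , f = N , λ n n≥ → subst (λ q → ℚ.∣ q ∣ ℚ.≤ ε) (a≗b n) (f n n≥)

null-0 : Null (λ _ → 0ℚ)
null-0 ε 0<ε = 0 , λ _ _ → ℚₚ.<⇒≤ 0<ε

null-+ : ∀ a b → Null a → Null b → Null (λ n → a n ℚ.+ b n)
null-+ a b na nb ε 0<ε
  with na (½ ℚ.* ε) (half-positive 0<ε) | nb (½ ℚ.* ε) (half-positive 0<ε)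
... | M , f | N , g = M ℕ.⊔ N , λ n n≥ → ℚₚ.≤-trans (ℚₚ.∣p+q∣≤∣p∣+∣q∣ (a n) (b n))
  (subst (_ ℚ.≤_) (halves ε)
    (ℚₚ.+-mono-≤ (f n (ℕₚ.m⊔n≤o⇒m≤o M N n≥)) (g n (ℕₚ.m⊔n≤o⇒n≤o M N n≥))))

null-neg : ∀ a → Null a → Null (λ n → ℚ.- a n)
null-neg a na ε 0<ε with na ε 0<ε
... | N , f = N , λ n n≥ → subst (ℚ._≤ ε) (sym (ℚₚ.∣-p∣≡∣p∣ (a n))) (f n n≥)

-- A Cauchy sequence is eventually bounded, and a bounded factor keeps a sequence null. The estimate
-- is `product-close` applied to `p * q` and `p * 0`.
null-* : ∀ x b → Null b → Null (λ n → seq x n ℚ.* b n)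
null-* x b nb ε 0<ε =
  let B , M , B>0 , x≤B = eventually-bounded (seq x) (cauchy x)
      δ , 0<δ , eq      = share B B B>0 B>0 0<ε
      N , b≤δ           = nb δ 0<δ
  in M ℕ.⊔ N , λ n n≥ →
    null-*-bound (seq x n) (b n) eq B>0 0<δ
      (x≤B n (ℕₚ.m⊔n≤o⇒m≤o M N n≥)) (b≤δ n (ℕₚ.m⊔n≤o⇒n≤o M N n≥))
  where
  null-*-bound : ∀ p q {B δ ε} → B ℚ.* δ ℚ.+ δ ℚ.* B ≡ ε → ℚ.Positive B → 0ℚ ℚ.< δ →
    ℚ.∣ p ∣ ℚ.≤ B → ℚ.∣ q ∣ ℚ.≤ δ → ℚ.∣ p ℚ.* q ∣ ℚ.≤ ε
  null-*-bound p q {B} {δ} {ε} eq B>0 0<δ p≤B q≤δ = subst (λ z → ℚ.∣ z ∣ ℚ.≤ ε)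
    (solve 2 (λ p q → p :* q :- p :* con 0ℚ := p :* q) refl p q)
    (product-close p q p 0ℚ eq p≤B
      (ℚₚ.nonNegative⁻¹ B ⦃ ℚₚ.pos⇒nonNeg B ⦃ B>0 ⦄ ⦄)
      (subst (λ z → ℚ.∣ z ∣ ℚ.≤ δ) (sym (ℚₚ.+-inverseʳ p)) (ℚₚ.<⇒≤ 0<δ))
      (subst (λ z → ℚ.∣ z ∣ ℚ.≤ δ) (sym (ℚₚ.+-identityʳ q)) q≤δ))

-- A record, so that x and y can be inferred from x ≃ y.
infix 4 _≃_
record _≃_ (x y : ℝ) : Set where
  constructor mk≃
  field un≃ : x ≈ᴿ y

open _≃_

-- Since the operations act termwise, a polynomial identity over the reals follows from the same
-- identity over the rationals, which the ring solver proves.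
pointwise : ∀ {x y} → (∀ n → seq x n ≡ seq y n) → x ≃ y
pointwise {x} {y} x≗y .un≃ = null-resp (λ _ → 0ℚ) _
  (λ n → sym (trans (cong (ℚ._- seq y n) (x≗y n)) (ℚₚ.+-inverseʳ (seq y n)))) null-0

≃-refl : ∀ {x} → x ≃ x
≃-refl = pointwise λ _ → refl

≃-sym : ∀ {x y} → x ≃ y → y ≃ x
≃-sym {x} {y} (mk≃ p) .un≃ = null-resp _ _
  (λ n → solve 2 (λ p q → :- (p :- q) := q :- p) refl (seq x n) (seq y n)) (null-neg _ p)

≃-trans : ∀ {x y z} → x ≃ y → y ≃ z → x ≃ z
≃-trans {x} {y} {z} (mk≃ p) (mk≃ q) .un≃ = null-resp _ _
  (λ n → solve 3 (λ p q r → (p :- q) :+ (q :- r) := p :- r) refl (seq x n) (seq y n) (seq z n))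
  (null-+ _ _ p q)

-- Abstract, like +-cauchy and *-cauchy, because unfolding it slows type checking down.
abstract
  neg-cauchy : ∀ a → IsCauchy a → IsCauchy (λ n → ℚ.- a n)
  neg-cauchy a ca ε 0<ε = let N , f = ca ε 0<ε in N , λ m n m≥ n≥ →
    subst (ℚ._≤ ε)
      (trans (sym (ℚₚ.∣-p∣≡∣p∣ (a m ℚ.- a n)))
        (cong ℚ.∣_∣ (solve 2 (λ p q → :- (p :- q) := (:- p) :- (:- q)) refl (a m) (a n))))
      (f m n m≥ n≥)

infix 8 -ᴿ_
-ᴿ_ : ℝ → ℝ
-ᴿ x = mkℝ (λ n → ℚ.- seq x n) (neg-cauchy (seq x) (cauchy x))

+-cong : ∀ {x y u v} → x ≃ y → u ≃ v → x +ᴿ u ≃ y +ᴿ v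
+-cong {x} {y} {u} {v} (mk≃ p) (mk≃ q) .un≃ = null-resp _ _
  (λ n → solve 4 (λ x y u v → (x :- y) :+ (u :- v) := (x :+ u) :- (y :+ v)) refl
    (seq x n) (seq y n) (seq u n) (seq v n))
  (null-+ _ _ p q)

neg-cong : ∀ {x y} → x ≃ y → -ᴿ x ≃ -ᴿ y
neg-cong {x} {y} (mk≃ p) .un≃ = null-resp _ _
  (λ n → solve 2 (λ x y → :- (x :- y) := (:- x) :- (:- y)) refl (seq x n) (seq y n))
  (null-neg _ p)

*-cong : ∀ {x y u v} → x ≃ y → u ≃ v → x *ᴿ u ≃ y *ᴿ v
*-cong {x} {y} {u} {v} (mk≃ p) (mk≃ q) .un≃ = null-resp _ _
  (λ n → solve 4 (λ x y u v → x :* (u :- v) :+ v :* (x :- y) := (x :* u) :- (y :* v)) refl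
    (seq x n) (seq y n) (seq u n) (seq v n))
  (null-+ _ _ (null-* x _ q) (null-* v _ p))

+-assoc : ∀ x y z → (x +ᴿ y) +ᴿ z ≃ x +ᴿ (y +ᴿ z)
+-assoc x y z = pointwise λ n → ℚₚ.+-assoc (seq x n) (seq y n) (seq z n)

+-comm : ∀ x y → x +ᴿ y ≃ y +ᴿ x
+-comm x y = pointwise λ n → ℚₚ.+-comm (seq x n) (seq y n)

+-identityˡ : ∀ x → 0ℝ +ᴿ x ≃ x
+-identityˡ x = pointwise λ n → ℚₚ.+-identityˡ (seq x n)

-‿inverseʳ : ∀ x → x +ᴿ -ᴿ x ≃ 0ℝ
-‿inverseʳ x = pointwise λ n → ℚₚ.+-inverseʳ (seq x n)

*-assoc : ∀ x y z → (x *ᴿ y) *ᴿ z ≃ x *ᴿ (y *ᴿ z)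
*-assoc x y z = pointwise λ n → ℚₚ.*-assoc (seq x n) (seq y n) (seq z n)

*-comm : ∀ x y → x *ᴿ y ≃ y *ᴿ x
*-comm x y = pointwise λ n → ℚₚ.*-comm (seq x n) (seq y n)

*-identityˡ : ∀ x → 1ℝ *ᴿ x ≃ x
*-identityˡ x = pointwise λ n → ℚₚ.*-identityˡ (seq x n)

*-distribˡ-+ : ∀ x y z → x *ᴿ (y +ᴿ z) ≃ x *ᴿ y +ᴿ x *ᴿ z
*-distribˡ-+ x y z = pointwise λ n → ℚₚ.*-distribˡ-+ (seq x n) (seq y n) (seq z n)

ℝ-setoid : Setoid 0ℓ 0ℓ
ℝ-setoid = record
  { _≈_ = _≃_
  ; isEquivalence = record { refl = ≃-refl ; sym = ≃-sym ; trans = ≃-trans } }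

ℝ-isCommutativeRing : IsCommutativeRing _≃_ _+ᴿ_ _*ᴿ_ -ᴿ_ 0ℝ 1ℝ
ℝ-isCommutativeRing = record
  { isRing = record
    { +-isAbelianGroup = record
      { isGroup = record
        { isMonoid = record
          { isSemigroup = record
            { isMagma = record { isEquivalence = Setoid.isEquivalence ℝ-setoid ; ∙-cong = +-cong }
            ; assoc = +-assoc }
          ; identity = comm∧idˡ⇒id +-comm +-identityˡ }
        ; inverse = comm∧invʳ⇒inv +-comm -‿inverseʳ
        ; ⁻¹-cong = neg-cong }
      ; comm = +-comm }
    ; *-cong = *-cong
    ; *-assoc = *-assoc
    ; *-identity = comm∧idˡ⇒id *-comm *-identityˡ
    ; distrib = comm∧distrˡ⇒distr +-cong *-comm *-distribˡ-+ }
  ; *-comm = *-comm }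
  where open Algebra.Consequences.Setoid ℝ-setoid

ℝ-commutativeRing : CommutativeRing 0ℓ 0ℓ
ℝ-commutativeRing = record { isCommutativeRing = ℝ-isCommutativeRing }

-- A uniform rational lower bound is required because a sequence of positive rationals may still
-- tend to zero.
record Pos (x : ℝ) : Set where
  constructor mkPos
  field
    bound     : ℚ
    bound>0   : 0ℚ ℚ.< bound
    threshold : ℕ
    above     : ∀ n → threshold ℕ.≤ n → bound ℚ.≤ seq x n

-- Later arguments split on whether an entry vanishes, hence the disjunction. Under excluded middle
-- it agrees with `0ℝ ≤ᴿ x`.
NonNeg : ℝ → Set
NonNeg x = Pos x ⊎ x ≃ 0ℝ

difference≤ : ∀ p q {ε} → ℚ.∣ p ℚ.- q ∣ ℚ.≤ ε → p ℚ.- ε ℚ.≤ q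
difference≤ p q {ε} h = begin
  p ℚ.- ε                   ≡⟨ solve 3 (λ p q e → p :- e := q :+ ((p :- q) :- e)) refl p q ε ⟩
  q ℚ.+ ((p ℚ.- q) ℚ.- ε)   ≤⟨ ℚₚ.+-monoʳ-≤ q (ℚₚ.+-monoˡ-≤ (ℚ.- ε) (ℚₚ.≤-trans (p≤∣p∣ (p ℚ.- q)) h)) ⟩
  q ℚ.+ (ε ℚ.- ε)           ≡⟨ solve 2 (λ q e → q :+ (e :- e) := q) refl q ε ⟩
  q ∎
  where
  open ℚₚ.≤-Reasoning
  p≤∣p∣ : ∀ p → p ℚ.≤ ℚ.∣ p ∣
  p≤∣p∣ p with ℚₚ.≤-total 0ℚ p
  ... | inj₁ 0≤p = ℚₚ.≤-reflexive (sym (ℚₚ.0≤p⇒∣p∣≡p 0≤p))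
  ... | inj₂ p≤0 = ℚₚ.≤-trans p≤0 (ℚₚ.0≤∣p∣ p)

ε-half : ∀ ε → ε ℚ.- ½ ℚ.* ε ≡ ½ ℚ.* ε
ε-half = solve 1 (λ e → e :- con ½ :* e := con ½ :* e) refl

Pos-resp-≃ : ∀ {x y} → x ≃ y → Pos x → Pos y
Pos-resp-≃ {x} {y} (mk≃ x≈y) (mkPos ε 0<ε M f) =
  let N , g = x≈y (½ ℚ.* ε) (half-positive 0<ε)
  in mkPos (½ ℚ.* ε) (half-positive 0<ε) (M ℕ.⊔ N) λ n n≥ →
  ℚₚ.≤-trans (ℚₚ.≤-reflexive (sym (ε-half ε)))
  (ℚₚ.≤-trans (ℚₚ.+-monoˡ-≤ (ℚ.- (½ ℚ.* ε)) (f n (ℕₚ.m⊔n≤o⇒m≤o M N n≥)))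
    (difference≤ (seq x n) (seq y n) (g n (ℕₚ.m⊔n≤o⇒n≤o M N n≥))))

Pos-+ : ∀ {x y} → Pos x → Pos y → Pos (x +ᴿ y)
Pos-+ (mkPos ε 0<ε M f) (mkPos δ 0<δ N g) = mkPos (ε ℚ.+ δ) (ℚₚ.+-mono-< 0<ε 0<δ) (M ℕ.⊔ N)
  λ n n≥ → ℚₚ.+-mono-≤ (f n (ℕₚ.m⊔n≤o⇒m≤o M N n≥)) (g n (ℕₚ.m⊔n≤o⇒n≤o M N n≥))

Pos-* : ∀ {x y} → Pos x → Pos y → Pos (x *ᴿ y)
Pos-* {x} {y} (mkPos ε 0<ε M f) (mkPos δ 0<δ N g) = mkPos (ε ℚ.* δ)
  (ℚₚ.positive⁻¹ _ ⦃ ℚₚ.pos*pos⇒pos ε ⦃ ℚ.positive 0<ε ⦄ δ ⦃ ℚ.positive 0<δ ⦄ ⦄) (M ℕ.⊔ N)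
  λ n n≥ →
    let ε≤x = f n (ℕₚ.m⊔n≤o⇒m≤o M N n≥)
        δ≤y = g n (ℕₚ.m⊔n≤o⇒n≤o M N n≥)
    in ℚₚ.≤-trans
      (ℚₚ.*-monoʳ-≤-nonNeg δ ⦃ ℚ.nonNegative (ℚₚ.<⇒≤ 0<δ) ⦄ ε≤x)
      (ℚₚ.*-monoˡ-≤-nonNeg (seq x n) ⦃ ℚ.nonNegative (ℚₚ.≤-trans (ℚₚ.<⇒≤ 0<ε) ε≤x) ⦄ δ≤y)

¬Pos-0 : ¬ Pos 0ℝ
¬Pos-0 (mkPos ε 0<ε N f) = ℚₚ.<-irrefl refl (ℚₚ.<-≤-trans 0<ε (f N ℕₚ.≤-refl))

Pos⇒≄0 : ∀ {x} → Pos x → ¬ x ≃ 0ℝ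
Pos⇒≄0 px x≃0 = ¬Pos-0 (Pos-resp-≃ x≃0 px)

Pos-asym : ∀ {x} → Pos x → ¬ Pos (-ᴿ x)
Pos-asym {x} p q =
  ¬Pos-0 (Pos-resp-≃ (CommutativeRing.-‿inverseʳ ℝ-commutativeRing x) (Pos-+ p q))

Pos-1 : Pos 1ℝ
Pos-1 = mkPos 1ℚ 0<1ℚ 0 λ _ _ → ℚₚ.≤-refl

NonNeg-0 : NonNeg 0ℝ
NonNeg-0 = inj₂ ≃-refl

NonNeg-resp-≃ : ∀ {x y} → x ≃ y → NonNeg x → NonNeg y
NonNeg-resp-≃ e (inj₁ p) = inj₁ (Pos-resp-≃ e p)
NonNeg-resp-≃ e (inj₂ p) = inj₂ (≃-trans (≃-sym e) p)

module R = CommutativeRing ℝ-commutativeRing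

Pos-+-NonNeg : ∀ {x y} → Pos x → NonNeg y → Pos (x +ᴿ y)
Pos-+-NonNeg p (inj₁ q) = Pos-+ p q
Pos-+-NonNeg {x} p (inj₂ y≃0) = Pos-resp-≃ (≃-sym (≃-trans (R.+-congˡ y≃0) (R.+-identityʳ x))) p

NonNeg-+-Pos : ∀ {x y} → NonNeg x → Pos y → Pos (x +ᴿ y)
NonNeg-+-Pos {x} {y} p q = Pos-resp-≃ (R.+-comm y x) (Pos-+-NonNeg q p)

NonNeg-+ : ∀ {x y} → NonNeg x → NonNeg y → NonNeg (x +ᴿ y)
NonNeg-+ (inj₁ p) q = inj₁ (Pos-+-NonNeg p q)
NonNeg-+ {x} {y} (inj₂ x≃0) q = NonNeg-resp-≃ (≃-sym (≃-trans (R.+-congʳ x≃0) (R.+-identityˡ y))) q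

NonNeg-* : ∀ {x y} → NonNeg x → NonNeg y → NonNeg (x *ᴿ y)
NonNeg-* (inj₁ p) (inj₁ q) = inj₁ (Pos-* p q)
NonNeg-* {x} {y} (inj₂ x≃0) _ = inj₂ (≃-trans (R.*-congʳ x≃0) (R.zeroˡ y))
NonNeg-* {x} {y} (inj₁ _) (inj₂ y≃0) = inj₂ (≃-trans (R.*-congˡ y≃0) (R.zeroʳ x))

NonNeg⇒≥0 : ∀ {x} → NonNeg x → 0ℝ ≤ᴿ x
NonNeg⇒≥0 {x} (inj₁ (mkPos δ 0<δ N f)) ε 0<ε = N , λ n n≥ →
  subst (ℚ._≤ seq x n ℚ.+ ε) (ℚₚ.+-identityʳ 0ℚ)
    (ℚₚ.+-mono-≤ (ℚₚ.≤-trans (ℚₚ.<⇒≤ 0<δ) (f n n≥)) (ℚₚ.<⇒≤ 0<ε))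
NonNeg⇒≥0 {x} (inj₂ x≃0) ε 0<ε =
  let N , f = un≃ (≃-sym x≃0) ε 0<ε in N , λ n n≥ → subst (ℚ._≤ seq x n ℚ.+ ε)
    (solve 1 (λ e → (con 0ℚ :- e) :+ e := con 0ℚ) refl ε)
    (ℚₚ.+-monoˡ-≤ ε (difference≤ 0ℚ (seq x n) (f n n≥)))

≥0⇒¬Pos-neg : ∀ {x} → 0ℝ ≤ᴿ x → ¬ Pos (-ᴿ x)
≥0⇒¬Pos-neg {x} 0≤x (mkPos ε 0<ε M f) with 0≤x (½ ℚ.* ε) (half-positive 0<ε)
... | N , g = ℚₚ.<-irrefl refl (ℚₚ.<-≤-trans (half-positive 0<ε) (begin
  ½ ℚ.* ε
    ≡⟨ ε-half ε ⟨
  ε ℚ.- ½ ℚ.* ε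
    ≤⟨ ℚₚ.+-monoˡ-≤ (ℚ.- (½ ℚ.* ε)) (f n (ℕₚ.m≤m⊔n M N)) ⟩
  ℚ.- seq x n ℚ.- ½ ℚ.* ε
    ≡⟨ solve 2 (λ x e → :- x :- e := con 0ℚ :- (x :+ e)) refl (seq x n) (½ ℚ.* ε) ⟩
  0ℚ ℚ.- (seq x n ℚ.+ ½ ℚ.* ε)
    ≤⟨ ℚₚ.+-monoʳ-≤ 0ℚ (ℚₚ.neg-antimono-≤ (g n (ℕₚ.m≤n⊔m M N))) ⟩
  0ℚ ∎))
  where
  open ℚₚ.≤-Reasoning
  n = M ℕ.⊔ N

-- Multiplication by `p * q`, which is at least `ε * ε`, turns the difference of the two inverses
-- into `- (p - q)`.
1/-difference : ∀ {ε} → 0ℚ ℚ.< ε → ∀ p q {p′ q′} → p ℚ.* p′ ≡ 1ℚ → q ℚ.* q′ ≡ 1ℚ →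
  ε ℚ.≤ p → ε ℚ.≤ q → ∀ {δ} → ℚ.∣ p ℚ.- q ∣ ℚ.≤ δ ℚ.* (ε ℚ.* ε) → ℚ.∣ p′ ℚ.- q′ ∣ ℚ.≤ δ
1/-difference {ε} 0<ε p q {p′} {q′} ep eq ε≤p ε≤q {δ} h =
  ℚₚ.*-cancelʳ-≤-pos (ε ℚ.* ε) ⦃ ε²>0 ⦄ (begin
  ℚ.∣ d ∣ ℚ.* (ε ℚ.* ε)
    ≤⟨ ℚₚ.*-monoˡ-≤-nonNeg ℚ.∣ d ∣ ⦃ ℚₚ.∣-∣-nonNeg d ⦄ ε²≤pq ⟩
  ℚ.∣ d ∣ ℚ.* (p ℚ.* q)
    ≡⟨ cong (ℚ.∣ d ∣ ℚ.*_) (ℚₚ.0≤p⇒∣p∣≡p (ℚₚ.≤-trans (ℚₚ.<⇒≤ (ℚₚ.positive⁻¹ _ ⦃ ε²>0 ⦄)) ε²≤pq)) ⟨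
  ℚ.∣ d ∣ ℚ.* ℚ.∣ p ℚ.* q ∣
    ≡⟨ ℚₚ.∣p*q∣≡∣p∣*∣q∣ d (p ℚ.* q) ⟨
  ℚ.∣ d ℚ.* (p ℚ.* q) ∣
    ≡⟨ cong ℚ.∣_∣ numerator ⟩
  ℚ.∣ ℚ.- (p ℚ.- q) ∣
    ≡⟨ ℚₚ.∣-p∣≡∣p∣ (p ℚ.- q) ⟩
  ℚ.∣ p ℚ.- q ∣
    ≤⟨ h ⟩
  δ ℚ.* (ε ℚ.* ε) ∎)
  where
  open ℚₚ.≤-Reasoning
  d = p′ ℚ.- q′
  ε²>0 : ℚ.Positive (ε ℚ.* ε)
  ε²>0 = ℚₚ.pos*pos⇒pos ε ⦃ ℚ.positive 0<ε ⦄ ε ⦃ ℚ.positive 0<ε ⦄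
  ε²≤pq : ε ℚ.* ε ℚ.≤ p ℚ.* q
  ε²≤pq = ℚₚ.≤-trans
    (ℚₚ.*-monoʳ-≤-nonNeg ε ⦃ ℚ.nonNegative (ℚₚ.<⇒≤ 0<ε) ⦄ ε≤p)
    (ℚₚ.*-monoˡ-≤-nonNeg p ⦃ ℚ.nonNegative (ℚₚ.≤-trans (ℚₚ.<⇒≤ 0<ε) ε≤p) ⦄ ε≤q)
  numerator : d ℚ.* (p ℚ.* q) ≡ ℚ.- (p ℚ.- q)
  numerator = trans
    (solve 4 (λ p q a b → (a :- b) :* (p :* q) := (p :* a) :* q :- (q :* b) :* p) refl p q p′ q′)
    (trans (cong₂ (λ a b → a ℚ.* q ℚ.- b ℚ.* p) ep eq)
      (solve 2 (λ p q → con 1ℚ :* q :- con 1ℚ :* p := :- (p :- q)) refl p q))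

-- The sequence is truncated from below at its eventual bound, so that every term is invertible.
abstract
  inverse : ∀ {x} → Pos x → ∃[ y ] x *ᴿ y ≃ 1ℝ
  inverse {x} (mkPos ε 0<ε N f) = mkℝ y y-cauchy , mk≃ λ δ 0<δ → N , λ n n≥ →
    subst (ℚ._≤ δ)
      (cong ℚ.∣_∣ (trans (sym (ℚₚ.+-inverseʳ 1ℚ))
        (cong (ℚ._- 1ℚ) (trans (sym (t*y n)) (cong (ℚ._* y n) (t≡x n n≥))))))
      (ℚₚ.<⇒≤ 0<δ)
    where
    t : ℕ → ℚ
    t n = ε ℚ.⊔ seq x n
    ε≤t : ∀ n → ε ℚ.≤ t n
    ε≤t n = ℚₚ.p≤p⊔q ε (seq x n)
    t≢0 : ∀ n → ℚ.NonZero (t n)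
    t≢0 n = ℚₚ.pos⇒nonZero (t n) ⦃ ℚ.positive (ℚₚ.<-≤-trans 0<ε (ε≤t n)) ⦄
    y : ℕ → ℚ
    y n = ℚ.1/_ (t n) ⦃ t≢0 n ⦄
    t*y : ∀ n → t n ℚ.* y n ≡ 1ℚ
    t*y n = ℚₚ.*-inverseʳ (t n) ⦃ t≢0 n ⦄
    t≡x : ∀ n → N ℕ.≤ n → t n ≡ seq x n
    t≡x n n≥ = ℚₚ.p≤q⇒p⊔q≡q (f n n≥)
    gap : ∀ {δ} → 0ℚ ℚ.< δ → 0ℚ ℚ.< δ ℚ.* (ε ℚ.* ε)
    gap {δ} 0<δ = ℚₚ.positive⁻¹ _ ⦃ ℚₚ.pos*pos⇒pos δ ⦃ ℚ.positive 0<δ ⦄ (ε ℚ.* ε)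
      ⦃ ℚₚ.pos*pos⇒pos ε ⦃ ℚ.positive 0<ε ⦄ ε ⦃ ℚ.positive 0<ε ⦄ ⦄ ⦄
    y-cauchy : IsCauchy y
    y-cauchy δ 0<δ =
      let M , g = cauchy x (δ ℚ.* (ε ℚ.* ε)) (gap 0<δ)
      in M ℕ.⊔ N , λ m n m≥ n≥ →
        1/-difference 0<ε (t m) (t n) (t*y m) (t*y n) (ε≤t m) (ε≤t n)
          (subst (λ q → ℚ.∣ q ∣ ℚ.≤ δ ℚ.* (ε ℚ.* ε))
            (sym (cong₂ ℚ._-_ (t≡x m (ℕₚ.m⊔n≤o⇒n≤o M N m≥)) (t≡x n (ℕₚ.m⊔n≤o⇒n≤o M N n≥))))
            (g m n (ℕₚ.m⊔n≤o⇒m≤o M N m≥) (ℕₚ.m⊔n≤o⇒m≤o M N n≥)))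

-- Trichotomy of the reals

data Sign (x : ℝ) : Set where
  positive : Pos x → Sign x
  null     : x ≃ 0ℝ → Sign x
  negative : Pos (-ᴿ x) → Sign x

-- From index `N` on, terms differ by at most half of `ε`, so one term that is at least `ε` keeps
-- all of them above the other half.
far-from-0⇒Pos : ∀ x {ε} N → 0ℚ ℚ.< ε →
  (∀ m n → N ℕ.≤ m → N ℕ.≤ n → ℚ.∣ seq x m ℚ.- seq x n ∣ ℚ.≤ ½ ℚ.* ε) →
  ∀ n → N ℕ.≤ n → ε ℚ.≤ seq x n → Pos x
far-from-0⇒Pos x {ε} N 0<ε close n n≥ ε≤x = mkPos (½ ℚ.* ε) (half-positive 0<ε) N λ m m≥ →
  ℚₚ.≤-trans (ℚₚ.≤-reflexive (sym (ε-half ε)))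
    (ℚₚ.≤-trans (ℚₚ.+-monoˡ-≤ (ℚ.- (½ ℚ.* ε)) ε≤x)
      (difference≤ (seq x n) (seq x m) (close n m n≥ m≥)))

-- A term of absolute value at least `ε` would, according to its sign, make `x` or its negative
-- positive.
¬Pos⇒small : ∀ x {ε} N → 0ℚ ℚ.< ε → ¬ Pos x → ¬ Pos (-ᴿ x) →
  (∀ m n → N ℕ.≤ m → N ℕ.≤ n → ℚ.∣ seq x m ℚ.- seq x n ∣ ℚ.≤ ½ ℚ.* ε) →
  ∀ n → N ℕ.≤ n → ℚ.∣ seq x n ∣ ℚ.≤ ε
¬Pos⇒small x {ε} N 0<ε ¬p ¬q close n n≥ with ℚₚ.≤-total ℚ.∣ seq x n ∣ ε
... | inj₁ h = h
... | inj₂ h with ℚₚ.∣p∣≡p∨∣p∣≡-p (seq x n)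
...   | inj₁ e = contradiction (far-from-0⇒Pos x N 0<ε close n n≥ (subst (ε ℚ.≤_) e h)) ¬p
...   | inj₂ e = contradiction
  (far-from-0⇒Pos (-ᴿ x) N 0<ε
    (λ m n m≥ n≥ → subst (ℚ._≤ ½ ℚ.* ε) (flip (seq x m) (seq x n)) (close m n m≥ n≥))
    n n≥ (subst (ε ℚ.≤_) e h)) ¬q
  where
  flip : ∀ p q → ℚ.∣ p ℚ.- q ∣ ≡ ℚ.∣ (ℚ.- p) ℚ.- (ℚ.- q) ∣
  flip p q = trans (sym (ℚₚ.∣-p∣≡∣p∣ (p ℚ.- q)))
    (cong ℚ.∣_∣ (solve 2 (λ p q → :- (p :- q) := (:- p) :- (:- q)) refl p q))

¬Pos⇒≃0 : ∀ x → ¬ Pos x → ¬ Pos (-ᴿ x) → x ≃ 0ℝ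
¬Pos⇒≃0 x ¬p ¬q .un≃ = null-resp (seq x) _ (λ n → sym (ℚₚ.+-identityʳ (seq x n))) λ ε 0<ε →
  let N , close = cauchy x (½ ℚ.* ε) (half-positive 0<ε)
  in N , ¬Pos⇒small x N 0<ε ¬p ¬q close

module Classical (em : ExcludedMiddle 0ℓ) where

  sign : ∀ x → Sign x
  sign x with em {P = Pos x} | em {P = Pos (-ᴿ x)}
  ... | yes p | _     = positive p
  ... | no _  | yes q = negative q
  ... | no ¬p | no ¬q = null (¬Pos⇒≃0 x ¬p ¬q)

  ≥0⇒NonNeg : ∀ {x} → 0ℝ ≤ᴿ x → NonNeg x
  ≥0⇒NonNeg {x} 0≤x with sign x
  ... | positive p = inj₁ p
  ... | null p     = inj₂ p
  ... | negative p = contradiction p (≥0⇒¬Pos-neg {x} 0≤x)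

-- Nonnegative kernel vectors of a matrix

open SemiringSum R.semiring using (sum; sum-cong-≋; *-distribˡ-sum; ∑-distrib-+; sum-replicate-zero)
open RingProperties R.ring using (-‿distribˡ-*; -‿distribʳ-*; -0#≈0#; -‿involutive)

dot : ∀ {n} → Vector ℝ n → Vector ℝ n → ℝ
dot a u = sum λ j → a j *ᴿ u j

sum-0 : ∀ {n} {a : Vector ℝ n} → (∀ i → a i ≃ 0ℝ) → sum a ≃ 0ℝ
sum-0 {n} a≃0 = ≃-trans (sum-cong-≋ a≃0) (sum-replicate-zero n)

dot-combine : ∀ {n} (a u v : Vector ℝ n) α β →
  dot a (λ i → α *ᴿ u i +ᴿ β *ᴿ v i) ≃ α *ᴿ dot a u +ᴿ β *ᴿ dot a v
dot-combine a u v α β = begin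
  sum (λ i → a i *ᴿ (α *ᴿ u i +ᴿ β *ᴿ v i))
    ≈⟨ sum-cong-≋ (λ i → pointwise λ k → solve 5
         (λ a u v α β → a :* (α :* u :+ β :* v) := α :* (a :* u) :+ β :* (a :* v)) refl
         (seq (a i) k) (seq (u i) k) (seq (v i) k) (seq α k) (seq β k)) ⟩
  sum (λ i → α *ᴿ (a i *ᴿ u i) +ᴿ β *ᴿ (a i *ᴿ v i))
    ≈⟨ ∑-distrib-+ (λ i → α *ᴿ (a i *ᴿ u i)) (λ i → β *ᴿ (a i *ᴿ v i)) ⟩
  sum (λ i → α *ᴿ (a i *ᴿ u i)) +ᴿ sum (λ i → β *ᴿ (a i *ᴿ v i))
    ≈⟨ +-cong (*-distribˡ-sum α (λ i → a i *ᴿ u i)) (*-distribˡ-sum β (λ i → a i *ᴿ v i)) ⟨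
  α *ᴿ dot a u +ᴿ β *ᴿ dot a v ∎
  where open SetoidReasoning R.setoid

-- The left side is a row with first entry `α` and tail `a`, applied to the vector obtained from `u`
-- by back substitution in the pivot row with first entry `β` and tail `b`. The right side applies
-- the reduced row to `u`.
eliminate : ∀ {n} (a b u : Vector ℝ n) α β →
  α *ᴿ (-ᴿ dot b u) +ᴿ sum (λ j → a j *ᴿ (β *ᴿ u j)) ≃
  sum (λ j → (β *ᴿ a j +ᴿ -ᴿ α *ᴿ b j) *ᴿ u j)
eliminate a b u α β = begin
  α *ᴿ (-ᴿ dot b u) +ᴿ sum (λ j → a j *ᴿ (β *ᴿ u j))
    ≈⟨ R.+-congʳ (pointwise λ k → solve 2 (λ α d → α :* (:- d) := :- α :* d) refl (seq α k) (seq (dot b u) k)) ⟩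
  -ᴿ α *ᴿ dot b u +ᴿ sum (λ j → a j *ᴿ (β *ᴿ u j))
    ≈⟨ R.+-congʳ (*-distribˡ-sum (-ᴿ α) (λ j → b j *ᴿ u j)) ⟩
  sum (λ j → -ᴿ α *ᴿ (b j *ᴿ u j)) +ᴿ sum (λ j → a j *ᴿ (β *ᴿ u j))
    ≈⟨ ∑-distrib-+ (λ j → -ᴿ α *ᴿ (b j *ᴿ u j)) (λ j → a j *ᴿ (β *ᴿ u j)) ⟨
  sum (λ j → -ᴿ α *ᴿ (b j *ᴿ u j) +ᴿ a j *ᴿ (β *ᴿ u j))
    ≈⟨ sum-cong-≋ (λ j → pointwise λ k → solve 5
         (λ a b u α β → :- α :* (b :* u) :+ a :* (β :* u) := (β :* a :+ :- α :* b) :* u) refl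
         (seq (a j) k) (seq (b j) k) (seq (u j) k) (seq α k) (seq β k)) ⟩
  sum (λ j → (β *ᴿ a j +ᴿ -ᴿ α *ᴿ b j) *ᴿ u j) ∎
  where open SetoidReasoning R.setoid

Kernel : ∀ {m n} → (Fin m → Vector ℝ n) → Vector ℝ n → Set
Kernel M u = ∀ r → dot (M r) u ≃ 0ℝ

Kernel-combine : ∀ {m n} (M : Fin m → Vector ℝ n) {u v} α β →
  Kernel M u → Kernel M v → Kernel M (λ i → α *ᴿ u i +ᴿ β *ᴿ v i)
Kernel-combine M {u} {v} α β ku kv r = begin
  dot (M r) (λ i → α *ᴿ u i +ᴿ β *ᴿ v i)  ≈⟨ dot-combine (M r) u v α β ⟩
  α *ᴿ dot (M r) u +ᴿ β *ᴿ dot (M r) v   ≈⟨ +-cong (R.*-congˡ (ku r)) (R.*-congˡ (kv r)) ⟩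
  α *ᴿ 0ℝ +ᴿ β *ᴿ 0ℝ                     ≈⟨ +-cong (R.zeroʳ α) (R.zeroʳ β) ⟩
  0ℝ +ᴿ 0ℝ                               ≈⟨ R.+-identityʳ 0ℝ ⟩
  0ℝ ∎
  where open SetoidReasoning R.setoid

record KernelVector {m n} (M : Fin m → Vector ℝ n) (A : Subset n) : Set where
  field
    vector      : Vector ℝ n
    nonzero     : ∃[ i ] ¬ vector i ≃ 0ℝ
    supported   : ∀ {i} → i ∉ A → vector i ≃ 0ℝ
    annihilated : Kernel M vector

open KernelVector

negate : ∀ {m n} {M : Fin m → Vector ℝ n} {A} → KernelVector M A → KernelVector M A
negate U .vector i = -ᴿ vector U i
negate U .nonzero = let i , u≄0 = nonzero U in i , λ e →
  u≄0 (≃-trans (≃-sym (-‿involutive _)) (≃-trans (neg-cong e) -0#≈0#))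
negate U .supported i∉A = ≃-trans (neg-cong (supported U i∉A)) -0#≈0#
-- The negative is the linear combination with coefficients 0 and -1, so `Kernel-combine` covers it.
negate {M = M} U .annihilated r =
  ≃-trans (sum-cong-≋ (λ i → pointwise λ k → solve 2
      (λ a u → a :* :- u := a :* (con 0ℚ :* u :+ (:- con 1ℚ) :* u)) refl (seq (M r i) k) (seq (vector U i) k)))
    (Kernel-combine M 0ℝ (-ᴿ 1ℝ) (annihilated U) (annihilated U) r)

record Solution {m n} (M : Fin m → Vector ℝ n) (w : Vector ℝ n) : Set where
  field
    nonNegative : ∀ i → NonNeg (w i)
    nontrivial  : ∃[ i ] Pos (w i)
    kernel      : Kernel M w

Redundant : ∀ {m n} → (Fin m → Vector ℝ n) → Fin n → Set
Redundant M s = ∃[ w ] Solution M w × w s ≃ 0ℝ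

∣p∣≤1+∣p-x∣ : ∀ {n} (p : Subset n) x → ∣ p ∣ ℕ.≤ suc ∣ p - x ∣
∣p∣≤1+∣p-x∣ (inside  ∷ p) zero    = s≤s (ℕₚ.≤-reflexive (cong ∣_∣ (sym (p─⊥≡p p))))
∣p∣≤1+∣p-x∣ (outside ∷ p) zero    = ℕₚ.m≤n⇒m≤1+n (ℕₚ.≤-reflexive (cong ∣_∣ (sym (p─⊥≡p p))))
∣p∣≤1+∣p-x∣ (inside  ∷ p) (suc x) = s≤s (∣p∣≤1+∣p-x∣ p x)
∣p∣≤1+∣p-x∣ (outside ∷ p) (suc x) = ∣p∣≤1+∣p-x∣ p x

x∉p-x : ∀ {n} (p : Subset n) x → x ∉ p - x
x∉p-x (inside  ∷ p) zero    ()
x∉p-x (outside ∷ p) zero    ()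
x∉p-x (_ ∷ p)       (suc x) (there x∈) = x∉p-x p x x∈

-- Kernel vectors, the exchange step and the bound on essential columns

module WithEM (em : ExcludedMiddle 0ℓ) where
  open Classical em
  open Solution

  ≄0-* : ∀ {x y} → ¬ x ≃ 0ℝ → ¬ y ≃ 0ℝ → ¬ x *ᴿ y ≃ 0ℝ
  ≄0-* {x} {y} x≄0 y≄0 xy≃0 with sign x | sign y
  ... | null p | _ = x≄0 p
  ... | _ | null p = y≄0 p
  ... | positive p | positive q = Pos⇒≄0 (Pos-* p q) xy≃0
  ... | positive p | negative q = Pos⇒≄0 (Pos-* p q)
    (≃-trans (≃-sym (-‿distribʳ-* x y)) (≃-trans (neg-cong xy≃0) -0#≈0#))
  ... | negative p | positive q = Pos⇒≄0 (Pos-* p q)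
    (≃-trans (≃-sym (-‿distribˡ-* x y)) (≃-trans (neg-cong xy≃0) -0#≈0#))
  ... | negative p | negative q = Pos⇒≄0 (Pos-* p q)
    (≃-trans (pointwise λ k → solve 2 (λ x y → :- x :* :- y := x :* y) refl (seq x k) (seq y k)) xy≃0)

  ¬Pos⇒NonNeg-neg : ∀ {x} → ¬ Pos x → NonNeg (-ᴿ x)
  ¬Pos⇒NonNeg-neg {x} ¬p with sign x
  ... | positive p = contradiction p ¬p
  ... | null p     = inj₂ (≃-trans (neg-cong p) -0#≈0#)
  ... | negative p = inj₁ p

  -- Gaussian elimination, one column at a time and without division.
  kernelVector : ∀ {m n} (M : Fin m → Vector ℝ n) (A : Subset n) → m ℕ.< ∣ A ∣ → KernelVector M A
  kernelVector M (outside ∷ A) m< = record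
    { vector = 0ℝ Vector.∷ vector U
    ; nonzero = let i , p = nonzero U in suc i , p
    ; supported = λ { {zero} _ → ≃-refl ; {suc i} i∉ → supported U (i∉ ∘ there) }
    ; annihilated = λ r → ≃-trans (+-cong (R.zeroʳ (M r zero)) (annihilated U r)) (R.+-identityʳ 0ℝ) }
    where U = kernelVector (λ r → M r ∘ suc) A m<
  kernelVector {m} {suc n} M (inside ∷ A) m< with em {P = ∃[ p ] ¬ M p zero ≃ 0ℝ}
  ... | no ∄pivot = record
    { vector = 1ℝ Vector.∷ λ _ → 0ℝ
    ; nonzero = zero , Pos⇒≄0 Pos-1
    ; supported = λ { {zero} i∉ → contradiction here i∉ ; {suc i} _ → ≃-refl }
    ; annihilated = λ r → ≃-trans
        (+-cong (≃-trans (R.*-identityʳ (M r zero)) (column r)) (sum-0 λ j → R.zeroʳ (M r (suc j))))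
        (R.+-identityʳ 0ℝ) }
    where
    column : ∀ r → M r zero ≃ 0ℝ
    column r with em {P = M r zero ≃ 0ℝ}
    ... | yes p = p
    ... | no ¬p = contradiction (r , ¬p) ∄pivot
  kernelVector {suc m} {suc n} M (inside ∷ A) (s≤s m<) | yes (p , pivot) = record
    -- The first entry makes the pivot row vanish; scaling the other entries by the pivot replaces
    -- the division.
    { vector = (-ᴿ dot (M p ∘ suc) u) Vector.∷ λ j → M p zero *ᴿ u j
    ; nonzero = let i , q = nonzero U in suc i , ≄0-* pivot q
    ; supported = λ { {zero} i∉ → contradiction here i∉
                    ; {suc i} i∉ → ≃-trans (R.*-congˡ (supported U (i∉ ∘ there))) (R.zeroʳ (M p zero)) }
    ; annihilated = λ r → ≃-trans (eliminate (M r ∘ suc) (M p ∘ suc) u (M r zero) (M p zero)) (row r) }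
    where
    reduced : Fin (suc m) → Vector ℝ n
    reduced r j = M p zero *ᴿ M r (suc j) +ᴿ -ᴿ M r zero *ᴿ M p (suc j)
    U = kernelVector (reduced ∘ punchIn p) A m<
    u = vector U
    row : ∀ r → dot (reduced r) u ≃ 0ℝ
    row r with p ≟ r
    -- The reduced pivot row is identically zero, so nothing was lost by dropping it with
    -- `punchIn p`.
    ... | yes refl = sum-0 λ j → pointwise λ k → solve 3
            (λ a b u → (a :* b :+ :- a :* b) :* u := con 0ℚ) refl
            (seq (M p zero) k) (seq (M p (suc j)) k) (seq (u j) k)
    ... | no p≢r = subst (λ r → dot (reduced r) u ≃ 0ℝ) (punchIn-punchOut p≢r) (annihilated U (punchOut p≢r))

  -- This is the ratio inequality at an index where `u` is not positive: there the signs alone give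
  -- it.
  cross≥0 : ∀ {a b c d} → NonNeg a → NonNeg b → NonNeg c → ¬ Pos d → NonNeg (a *ᴿ b +ᴿ -ᴿ c *ᴿ d)
  cross≥0 {c = c} {d} a≥0 b≥0 c≥0 d≯0 = NonNeg-+ (NonNeg-* a≥0 b≥0)
    (NonNeg-resp-≃ (pointwise λ k → solve 2 (λ c d → c :* :- d := :- c :* d) refl (seq c k) (seq d k))
      (NonNeg-* c≥0 (¬Pos⇒NonNeg-neg d≯0)))

  NonNeg-cancel-* : ∀ {a b} → Pos a → NonNeg (a *ᴿ b) → NonNeg b
  NonNeg-cancel-* {a} {b} a>0 ab≥0 with sign b
  ... | positive p = inj₁ p
  ... | null p     = inj₂ p
  ... | negative p = contradiction
    (≃-trans (R.+-congˡ (≃-sym (-‿distribʳ-* a b))) (R.-‿inverseʳ (a *ᴿ b)))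
    (Pos⇒≄0 (NonNeg-+-Pos ab≥0 (Pos-* a>0 p)))

  -- The index s minimises w s / u s among those with u s > 0.
  minimal-ratio : ∀ {n} (w u : Vector ℝ n) → (∀ i → NonNeg (w i)) → (∃[ i ] Pos (u i)) →
    ∃[ s ] Pos (u s) × ∀ i → NonNeg (u s *ᴿ w i +ᴿ -ᴿ w s *ᴿ u i)
  minimal-ratio {suc n} w u w≥0 (i , uᵢ>0) with em {P = ∃[ i ] Pos (u (suc i))}
  minimal-ratio {suc n} w u w≥0 (suc i , uᵢ>0) | no ∄ = contradiction (i , uᵢ>0) ∄
  minimal-ratio {suc n} w u w≥0 (zero , u₀>0) | no ∄ = zero , u₀>0 , λ
    { zero → inj₂ (pointwise λ k → solve 2 (λ u w → u :* w :+ :- w :* u := con 0ℚ) refl (seq (u zero) k) (seq (w zero) k))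
    ; (suc i) → cross≥0 (inj₁ u₀>0) (w≥0 (suc i)) (w≥0 zero) (λ p → ∄ (i , p)) }
  minimal-ratio {suc n} w u w≥0 _ | yes ∃i
    with minimal-ratio (w ∘ suc) (u ∘ suc) (w≥0 ∘ suc) ∃i
  ... | s , uₛ>0 , least with sign (u (suc s) *ᴿ w zero +ᴿ -ᴿ w (suc s) *ᴿ u zero)
  ...   | positive p = suc s , uₛ>0 , λ { zero → inj₁ p ; (suc i) → least i }
  ...   | null p     = suc s , uₛ>0 , λ { zero → inj₂ p ; (suc i) → least i }
  ...   | negative q with em {P = Pos (u zero)}
  ...     | no u₀≯0 = suc s , uₛ>0 , λ
    { zero → cross≥0 (inj₁ uₛ>0) (w≥0 zero) (w≥0 (suc s)) u₀≯0 ; (suc i) → least i }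
  ...     | yes u₀>0 = zero , u₀>0 , λ
    { zero → inj₂ (pointwise λ k → solve 2 (λ u w → u :* w :+ :- w :* u := con 0ℚ) refl (seq (u zero) k) (seq (w zero) k))
    ; (suc i) → tail≥0 i }
    where
    tail≥0 : ∀ i → NonNeg (u zero *ᴿ w (suc i) +ᴿ -ᴿ w zero *ᴿ u (suc i))
    tail≥0 i with em {P = Pos (u (suc i))}
    ... | no uᵢ≯0 = cross≥0 (inj₁ u₀>0) (w≥0 (suc i)) (w≥0 zero) uᵢ≯0
    -- Transitivity of the comparison of ratios, cleared of denominators: `u zero` times the
    -- inequality between `suc s` and `suc i`, plus `u (suc i)` times the one between zero and
    -- `suc s`, is `u (suc s)` times the desired one.
    ... | yes uᵢ>0 = NonNeg-cancel-* uₛ>0 (NonNeg-resp-≃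
      (pointwise λ k → solve 6 (λ u₀ uᵢ uₛ w₀ wᵢ wₛ →
          u₀ :* (uₛ :* wᵢ :+ :- wₛ :* uᵢ) :+ uᵢ :* (:- (uₛ :* w₀ :+ :- wₛ :* u₀)) :=
          uₛ :* (u₀ :* wᵢ :+ :- w₀ :* uᵢ)) refl
        (seq (u zero) k) (seq (u (suc i)) k) (seq (u (suc s)) k)
        (seq (w zero) k) (seq (w (suc i)) k) (seq (w (suc s)) k))
      (NonNeg-+ (NonNeg-* (inj₁ u₀>0) (least i)) (NonNeg-* (inj₁ uᵢ>0) (inj₁ q))))

  -- Subtract from w the largest multiple of u that keeps it nonnegative; the result is still
  -- nonzero at e.
  exchange : ∀ {m n} (M : Fin m → Vector ℝ n) {w u} → Solution M w → Kernel M u →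
    ∀ {e} → Pos (w e) → u e ≃ 0ℝ → (∃[ i ] Pos (u i)) → ∃[ s ] Pos (u s) × Redundant M s
  exchange M {w} {u} W ku {e} wₑ>0 uₑ≃0 ∃i with minimal-ratio w u (nonNegative W) ∃i
  ... | s , uₛ>0 , ratio = s , uₛ>0 , w′ , record
      { nonNegative = ratio
      ; nontrivial = e , Pos-resp-≃ (≃-sym (≃-trans (R.+-congˡ (≃-trans (R.*-congˡ uₑ≃0) (R.zeroʳ _))) (R.+-identityʳ _)))
                           (Pos-* uₛ>0 wₑ>0)
      ; kernel = Kernel-combine M (u s) (-ᴿ w s) (kernel W) ku }
    , (pointwise λ k → solve 2 (λ u w → u :* w :+ :- w :* u := con 0ℚ) refl (seq (u s) k) (seq (w s) k))
    where
    -- This is w - (w s / u s) u, multiplied by `u s` to avoid the division.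
    w′ = λ i → u s *ᴿ w i +ᴿ -ᴿ w s *ᴿ u i

  -- A vector or its negative qualifies. Applied at the additional point `x`, this keeps positive
  -- entries away from it.
  negative-at : ∀ {m n} {M : Fin m → Vector ℝ n} {A} → KernelVector M A → ∀ x →
    Σ (KernelVector M A) λ U → ¬ Pos (vector U x)
  negative-at U x with em {P = Pos (vector U x)}
  ... | no ¬p = U , ¬p
  ... | yes p = negate U , Pos-asym p

  -- One point is to be deleted from `A` later, so `C` receives one more point `x`. If no point lies
  -- outside `C`, then `C` has all `n > suc m` points already, and `c` serves as a dummy value of
  -- `x`.
  enlarge : ∀ {n m} (C : Subset n) {c} → c ∈ C → m ℕ.< ∣ C ∣ → suc m ℕ.< n →
    ∃[ A ] ∃[ x ] suc m ℕ.< ∣ A ∣ × (∀ {s} → s ∈ A → s ≡ x ⊎ s ∈ C)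
  enlarge {n} {m} C {c} c∈C m<C 1+m<n with em {P = ∃[ x ] x ∉ C}
  ... | yes (x , x∉C) = C ∪ ⁅ x ⁆ , x
      , ℕₚ.≤-<-trans m<C (p⊂q⇒∣p∣<∣q∣ (p⊆p∪q ⁅ x ⁆ , x , q⊆p∪q C ⁅ x ⁆ (x∈⁅x⁆ x) , x∉C))
      , λ s∈A → split (x∈p∪q⁻ C ⁅ x ⁆ s∈A)
    where
    split : ∀ {s} → s ∈ C ⊎ s ∈ ⁅ x ⁆ → s ≡ x ⊎ s ∈ C
    split (inj₁ s∈C) = inj₂ s∈C
    split (inj₂ s∈x) = inj₁ (x∈⁅y⁆⇒x≡y x s∈x)
  ... | no ∄x = C , c , subst (suc m ℕ.<_) (sym (trans (cong ∣_∣ C≡⊤) (∣⊤∣≡n n))) 1+m<n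
      , inj₂
    where
    C≡⊤ = ⊆-antisym ⊆⊤ λ {x} _ → decidable-stable (x ∈? C) λ x∉C → ∄x (x , x∉C)

  -- The sign condition at `x` confines the positive entries of `u` to `C`, so the index at which
  -- `exchange` produces a zero lies in `C`.
  redundant-member : ∀ {m n} (M : Fin m → Vector ℝ n) {w} → Solution M w → ∀ C {c x} {A : Subset n} →
    c ∈ C → Pos (w c) → (∀ {s} → s ∈ A → s ≡ x ⊎ s ∈ C) →
    (U : KernelVector M (A - c)) → ¬ Pos (vector U x) → ∃[ s ] s ∈ C × Redundant M s
  redundant-member M {w} W C {c} {x} {A} c∈C w꜀>0 A⊆ U uₓ≯0 = dichotomy em
    where
    u = vector U
    u꜀≃0 : u c ≃ 0ℝ
    u꜀≃0 = supported U (x∉p-x A c)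
    uᵢ>0⇒i∈C : ∀ {i} → Pos (u i) → i ∈ C
    uᵢ>0⇒i∈C {i} p = [ (λ i≡x → contradiction (subst (Pos ∘ u) i≡x p) uₓ≯0) , id ]′
      (A⊆ (p─q⊆p A ⁅ c ⁆ (decidable-stable (i ∈? (A - c)) λ i∉ → Pos⇒≄0 p (supported U i∉))))
    dichotomy : Dec (∃[ i ] Pos (u i)) → ∃[ s ] s ∈ C × Redundant M s
    dichotomy (yes ∃i) =
      let s , uₛ>0 , redundant = exchange M W (annihilated U) w꜀>0 u꜀≃0 ∃i
      in s , uᵢ>0⇒i∈C uₛ>0 , redundant
    dichotomy (no ∄i) = c , c∈C , vector (negate U) , solution , ≃-trans (neg-cong u꜀≃0) -0#≈0#
      where
      positive-entry : ∃[ i ] ¬ -ᴿ u i ≃ 0ℝ → ∃[ i ] Pos (-ᴿ u i)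
      positive-entry (i , -u≄0) with ¬Pos⇒NonNeg-neg (λ p → ∄i (i , p))
      ... | inj₁ p = i , p
      ... | inj₂ p = contradiction p -u≄0
      solution : Solution M (vector (negate U))
      solution = record
        { nonNegative = λ i → ¬Pos⇒NonNeg-neg λ p → ∄i (i , p)
        ; nontrivial = positive-entry (nonzero (negate U))
        ; kernel = annihilated (negate U) }

  -- The kernel vector has to vanish at some `c` in `C`, so that the exchanged solution stays
  -- nonzero there. This costs one column, for which the point added by `enlarge` makes up.
  non-redundant-bound : ∀ {m n} (M : Fin m → Vector ℝ n) → suc m ℕ.< n → ∀ {w} → Solution M w →
    ∀ C → (∀ {c} → c ∈ C → ¬ Redundant M c) → ∣ C ∣ ℕ.≤ m
  non-redundant-bound {m} {n} M 1+m<n {w} W C essential = ℕₚ.≮⇒≥ λ m<C → impossible m<C (nonempty? C)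
    where
    w>0 : ∀ {c} → c ∈ C → Pos (w c)
    w>0 {c} c∈C with nonNegative W c
    ... | inj₁ p = p
    ... | inj₂ p = contradiction (w , W , p) (essential c∈C)
    impossible : m ℕ.< ∣ C ∣ → ¬ Dec (Nonempty C)
    impossible m<C (no ¬ne) =
      ℕₚ.n≮0 (subst (m ℕ.<_) (trans (cong ∣_∣ (Empty-unique ¬ne)) (∣⊥∣≡0 n)) m<C)
    impossible m<C (yes (c , c∈C)) =
      let A , x , 1+m<A , A⊆ = enlarge C c∈C m<C 1+m<n
          m<A-c              = ℕₚ.≤-pred (ℕₚ.≤-trans 1+m<A (∣p∣≤1+∣p-x∣ A c))
          U , uₓ≯0           = negative-at (kernelVector M (A - c) m<A-c) x
          s , s∈C , redundant = redundant-member M W C c∈C (w>0 c∈C) A⊆ U uₓ≯0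
      in essential s∈C redundant

-- Tverberg partitions as nonnegative kernel vectors

indicator : ∀ {n} → Subset n → Fin n → ℝ
indicator A i = if does (i ∈? A) then 1ℝ else 0ℝ

indicator-∈ : ∀ {n} {A : Subset n} {i} → i ∈ A → indicator A i ≡ 1ℝ
indicator-∈ {A = A} {i} i∈A with i ∈? A
... | yes _  = refl
... | no i∉A = contradiction i∈A i∉A

sum≥0 : ∀ {n} {a : Vector ℝ n} → (∀ i → NonNeg (a i)) → NonNeg (sum a)
sum≥0 {zero}  a≥0 = NonNeg-0
sum≥0 {suc n} a≥0 = NonNeg-+ (a≥0 zero) (sum≥0 (a≥0 ∘ suc))

sum>0 : ∀ {n} {a : Vector ℝ n} → (∀ i → NonNeg (a i)) → ∀ {i} → Pos (a i) → Pos (sum a)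
sum>0 a≥0 {zero}  aᵢ>0 = Pos-+-NonNeg aᵢ>0 (sum≥0 (a≥0 ∘ suc))
sum>0 a≥0 {suc i} aᵢ>0 = NonNeg-+-Pos (a≥0 zero) (sum>0 (a≥0 ∘ suc) aᵢ>0)

module Labelling {n r} (P : Partition n r) where
  open Partition P

  label : Fin n → Fin r
  label s = proj₁ (covers s)

  ∈-label : ∀ s → s ∈ part (label s)
  ∈-label s = proj₂ (covers s)

  label-unique : ∀ {s j} → s ∈ part j → label s ≡ j
  label-unique {s} {j} s∈ = decidable-stable (label s ≟ j) λ l≢j → disjoint l≢j (s , x∈p∩q⁺ (∈-label s , s∈))

-- Here `r` is one less than the number of parts, so `suc d * r` is the number of rows of the
-- matrix.
module Weights (em : ExcludedMiddle 0ℓ) {d n r} (S : PointSet d n) (P : Partition n (suc r)) where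
  open Classical em
  open WithEM em
  open PointSet S
  open Partition P
  open Labelling P

  -- The constant coordinate zero makes the total weight of a part one of its moments.
  homogeneous : Fin n → Fin (suc d) → ℝ
  homogeneous i zero    = 1ℝ
  homogeneous i (suc k) = point i k

  moment : Vector ℝ n → Fin (suc r) → Fin (suc d) → ℝ
  moment w j k = sum λ i → w i *ᴿ (indicator (part j) i *ᴿ homogeneous i k)

  -- A kernel vector gives all parts the same total weight and the same weighted sum of points.
  rows : Fin (suc d) → Fin r → Vector ℝ n
  rows k j i = (indicator (part (suc j)) i +ᴿ -ᴿ indicator (part zero) i) *ᴿ homogeneous i k

  -- Column `i` is the tensor product of the homogeneous point with a unit vector, or with minus the
  -- all-ones vector if the point lies in part zero. This is Sarkaria's construction.
  matrix : Fin (suc d ℕ.* r) → Vector ℝ n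
  matrix t = let k , j = remQuot r t in rows k j

  rows-dot : ∀ w k j → dot (rows k j) w ≃ moment w (suc j) k +ᴿ -ᴿ moment w zero k
  rows-dot w k j = begin
    sum (λ i → (a i +ᴿ -ᴿ b i) *ᴿ q i *ᴿ w i)
      ≈⟨ sum-cong-≋ (λ i → pointwise λ t → solve 4
           (λ a b q w → (a :+ :- b) :* q :* w := con 1ℚ :* (w :* (a :* q)) :+ (:- con 1ℚ) :* (w :* (b :* q))) refl
           (seq (a i) t) (seq (b i) t) (seq (q i) t) (seq (w i) t)) ⟩
    sum (λ i → 1ℝ *ᴿ (w i *ᴿ (a i *ᴿ q i)) +ᴿ (-ᴿ 1ℝ) *ᴿ (w i *ᴿ (b i *ᴿ q i)))
      ≈⟨ ∑-distrib-+ (λ i → 1ℝ *ᴿ (w i *ᴿ (a i *ᴿ q i))) (λ i → (-ᴿ 1ℝ) *ᴿ (w i *ᴿ (b i *ᴿ q i))) ⟩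
    sum (λ i → 1ℝ *ᴿ (w i *ᴿ (a i *ᴿ q i))) +ᴿ sum (λ i → (-ᴿ 1ℝ) *ᴿ (w i *ᴿ (b i *ᴿ q i)))
      ≈⟨ +-cong (*-distribˡ-sum 1ℝ (λ i → w i *ᴿ (a i *ᴿ q i))) (*-distribˡ-sum (-ᴿ 1ℝ) (λ i → w i *ᴿ (b i *ᴿ q i))) ⟨
    1ℝ *ᴿ moment w (suc j) k +ᴿ (-ᴿ 1ℝ) *ᴿ moment w zero k
      ≈⟨ pointwise (λ t → solve 2 (λ x y → con 1ℚ :* x :+ (:- con 1ℚ) :* y := x :+ :- y) refl
           (seq (moment w (suc j) k) t) (seq (moment w zero k) t)) ⟩
    moment w (suc j) k +ᴿ -ᴿ moment w zero k ∎
    where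
    open SetoidReasoning R.setoid
    a = indicator (part (suc j))
    b = indicator (part zero)
    q = λ i → homogeneous i k

  moments-agree : ∀ {w} → Kernel matrix w → ∀ j k → moment w j k ≃ moment w zero k
  moments-agree kw zero    k = ≃-refl
  moments-agree {w} kw (suc j) k = x∙y⁻¹≈ε⇒x≈y _ _ (≃-trans (≃-sym (rows-dot w k j)) row≃0)
    where
    open AbelianGroupProperties R.+-abelianGroup using (x∙y⁻¹≈ε⇒x≈y)
    row≃0 : dot (rows k j) w ≃ 0ℝ
    row≃0 = subst (λ (k , j) → dot (rows k j) w ≃ 0ℝ) (remQuot-combine k j) (kw (combine k j))

  kernel-of-moments : ∀ {w} → (∀ j k → moment w j k ≃ moment w zero k) → Kernel matrix w
  kernel-of-moments {w} agree t =
    let k , j = remQuot r t in ≃-trans (rows-dot w k j)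
      (≃-trans (R.+-congʳ (agree (suc j) k)) (R.-‿inverseʳ (moment w zero k)))

  restrict : Vector ℝ n → Fin (suc r) → Vector ℝ n
  restrict w j i = w i *ᴿ indicator (part j) i

  restrict-∈ : ∀ w {j i} → i ∈ part j → restrict w j i ≃ w i
  restrict-∈ w {j} {i} i∈ = ≃-trans (R.*-congˡ (R.reflexive (indicator-∈ i∈))) (R.*-identityʳ (w i))

  restrict≥0 : ∀ {w} → (∀ i → NonNeg (w i)) → ∀ j i → NonNeg (restrict w j i)
  restrict≥0 {w} w≥0 j i with i ∈? part j
  ... | yes _ = NonNeg-* (w≥0 i) (inj₁ Pos-1)
  ... | no  _ = NonNeg-* (w≥0 i) NonNeg-0

  moment-restrict : ∀ w j k → moment w j k ≃ sum (λ i → restrict w j i *ᴿ homogeneous i k)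
  moment-restrict w j k = sum-cong-≋ λ i → ≃-sym (R.*-assoc (w i) _ _)

  moment-0 : ∀ w j → moment w j zero ≃ sum (restrict w j)
  moment-0 w j = ≃-trans (moment-restrict w j zero) (sum-cong-≋ λ i → R.*-identityʳ (restrict w j i))

  module _ {w} (W : Solution matrix w) where
    open Solution W

    -- The part that contains a positive entry has positive total, and all totals agree.
    total>0 : ∀ j → Pos (moment w j zero)
    total>0 j = Pos-resp-≃ (≃-trans (≃-sym (moment-0 w (label i)))
        (≃-trans (moments-agree kernel (label i) zero) (≃-sym (moments-agree kernel j zero))))
      (sum>0 (restrict≥0 nonNegative (label i)) {i} (Pos-resp-≃ (≃-sym (restrict-∈ w (∈-label i))) wᵢ>0))
      where
      i    = proj₁ nontrivial
      wᵢ>0 = proj₂ nontrivial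

    -- Otherwise the total of the part would be zero. For a solution that vanishes at `s`, this
    -- yields another point in the part of `s`.
    positive-in : ∀ j → ∃[ i ] i ∈ part j × Pos (w i)
    positive-in j with em {P = ∃[ i ] i ∈ part j × Pos (w i)}
    ... | yes p = p
    ... | no ∄i = contradiction (≃-trans (moment-0 w j) (sum-0 zeros)) (Pos⇒≄0 (total>0 j))
      where
      zeros : ∀ i → restrict w j i ≃ 0ℝ
      zeros i with i ∈? part j | nonNegative i
      ... | no _   | _      = R.zeroʳ (w i)
      ... | yes i∈ | inj₁ p = contradiction (i , i∈ , p) ∄i
      ... | yes i∈ | inj₂ p = ≃-trans (R.*-congʳ p) (R.zeroˡ 1ℝ)

    scale : ℝ
    scale = proj₁ (inverse (total>0 zero))

    total*scale : moment w zero zero *ᴿ scale ≃ 1ℝ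
    total*scale = proj₂ (inverse (total>0 zero))

    scale≥0 : NonNeg scale
    scale≥0 = NonNeg-cancel-* (total>0 zero) (NonNeg-resp-≃ (≃-sym total*scale) (inj₁ Pos-1))

    centre : ℝ^ d
    centre k = scale *ᴿ moment w zero (suc k)

    -- The set `A` only has to contain the points of the part that carry weight. This freedom is
    -- what allows a point of weight zero to leave the part.
    centre-∈conv : ∀ j {A} → (∀ {i} → i ∈ part j → i ∉ A → w i ≃ 0ℝ) → centre ∈conv[ S ] A
    centre-∈conv j {A} outside≃0 = record
      { weight = λ i → scale *ᴿ restrict w j i
      ; nonNegative = λ i → NonNeg⇒≥0 (NonNeg-* scale≥0 (restrict≥0 nonNegative j i))
      ; supported = λ i∉A → un≃ (≃-trans (R.*-congˡ (vanishes i∉A)) (R.zeroʳ scale))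
      ; total = un≃ total≃1
      ; combination = λ k → un≃ (combination≃ k) }
      where
      open SetoidReasoning R.setoid
      vanishes : ∀ {i} → i ∉ A → restrict w j i ≃ 0ℝ
      vanishes {i} i∉A with i ∈? part j
      ... | yes i∈ = ≃-trans (R.*-congʳ (outside≃0 i∈ i∉A)) (R.zeroˡ 1ℝ)
      ... | no _   = R.zeroʳ (w i)
      total≃1 : sum (λ i → scale *ᴿ restrict w j i) ≃ 1ℝ
      total≃1 = begin
        sum (λ i → scale *ᴿ restrict w j i)  ≈⟨ *-distribˡ-sum scale (restrict w j) ⟨
        scale *ᴿ sum (restrict w j)          ≈⟨ R.*-congˡ (moment-0 w j) ⟨
        scale *ᴿ moment w j zero             ≈⟨ R.*-congˡ (moments-agree kernel j zero) ⟩
        scale *ᴿ moment w zero zero          ≈⟨ R.*-comm scale _ ⟩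
        moment w zero zero *ᴿ scale          ≈⟨ total*scale ⟩
        1ℝ ∎
      combination≃ : ∀ k → sum (λ i → scale *ᴿ restrict w j i *ᴿ point i k) ≃ centre k
      combination≃ k = begin
        sum (λ i → scale *ᴿ restrict w j i *ᴿ point i k)
          ≈⟨ sum-cong-≋ (λ i → R.*-assoc scale (restrict w j i) (point i k)) ⟩
        sum (λ i → scale *ᴿ (restrict w j i *ᴿ point i k))
          ≈⟨ *-distribˡ-sum scale (λ i → restrict w j i *ᴿ point i k) ⟨
        scale *ᴿ sum (λ i → restrict w j i *ᴿ point i k)
          ≈⟨ R.*-congˡ (moment-restrict w j (suc k)) ⟨
        scale *ᴿ moment w j (suc k)
          ≈⟨ R.*-congˡ (moments-agree kernel j (suc k)) ⟩
        centre k ∎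

  -- Each point takes the weight that it has in the convex combination for its own part. The moments
  -- of every part are then 1 followed by the coordinates of `y`.
  solution : IsTverberg S P → ∃ (Solution matrix)
  solution (y , y∈) = w , record
    { nonNegative = λ i → ≥0⇒NonNeg (C.nonNegative (label i) i)
    ; nontrivial = positive-entry
    ; kernel = kernel-of-moments agree }
    where
    module C j = _∈conv[_]_ (y∈ j)
    w : Vector ℝ n
    w i = C.weight (label i) i
    restrict≃weight : ∀ j i → restrict w j i ≃ C.weight j i
    restrict≃weight j i with i ∈? part j
    ... | yes i∈ = ≃-trans (R.*-identityʳ (w i)) (R.reflexive (cong (λ j → C.weight j i) (label-unique i∈)))
    ... | no i∉  = ≃-trans (R.zeroʳ (w i)) (≃-sym (mk≃ (C.supported j i∉)))
    moment≃ : ∀ j k → moment w j k ≃ sum (λ i → C.weight j i *ᴿ homogeneous i k)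
    moment≃ j k = ≃-trans (moment-restrict w j k) (sum-cong-≋ λ i → R.*-congʳ (restrict≃weight j i))
    moment-value : ∀ j k → moment w j k ≃ (1ℝ Vector.∷ y) k
    moment-value j zero    = ≃-trans (moment≃ j zero)
      (≃-trans (sum-cong-≋ λ i → R.*-identityʳ (C.weight j i)) (mk≃ (C.total j)))
    moment-value j (suc k) = ≃-trans (moment≃ j (suc k)) (mk≃ (C.combination j k))
    agree : ∀ j k → moment w j k ≃ moment w zero k
    agree j k = ≃-trans (moment-value j k) (≃-sym (moment-value zero k))
    positive-entry : ∃[ i ] Pos (w i)
    positive-entry with em {P = ∃[ i ] Pos (w i)}
    ... | yes p = p
    ... | no ∄i = contradiction
      (≃-trans (≃-sym (moment-value zero zero)) (≃-trans (moment-0 w zero) (sum-0 zeros)))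
      (Pos⇒≄0 Pos-1)
      where
      zeros : ∀ i → restrict w zero i ≃ 0ℝ
      zeros i = ≃-trans (R.*-congʳ ([ (λ p → contradiction (i , p) ∄i) , id ]′ (≥0⇒NonNeg (C.nonNegative (label i) i))))
        (R.zeroˡ _)

-- Partitions as labellings, and moving a point

select : ∀ {n} {P : Fin n → Set} → (∀ i → Dec (P i)) → Subset n
select P? = tabulate (does ∘ P?)

∈-select⁺ : ∀ {n} {P : Fin n → Set} (P? : ∀ i → Dec (P i)) {i} → P i → i ∈ select P?
∈-select⁺ P? {i} p = lookup⇒[]= i _ (trans (lookup∘tabulate (does ∘ P?) i) (dec-true (P? i) p))

∈-select⁻ : ∀ {n} {P : Fin n → Set} (P? : ∀ i → Dec (P i)) {i} → i ∈ select P? → P i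
∈-select⁻ P? {i} i∈ with P? i | trans (sym (lookup∘tabulate (does ∘ P?) i)) ([]=⇒lookup i∈)
... | yes p | _ = p

record Enumeration {n} (A : Subset n) : Set where
  field
    element    : Fin ∣ A ∣ → Fin n
    injective  : Injective _≡_ _≡_ element
    member     : ∀ k → element k ∈ A
    exhaustive : ∀ {i} → i ∈ A → ∃[ k ] element k ≡ i

open Enumeration

enumerate : ∀ {n} (A : Subset n) → Enumeration A
enumerate [] = record { element = λ () ; injective = λ {} ; member = λ () ; exhaustive = λ () }
enumerate (outside ∷ A) = record
  { element    = suc ∘ element E
  ; injective  = injective E ∘ suc-injective
  ; member     = there ∘ member E
  ; exhaustive = λ { (there i∈A) → let k , eq = exhaustive E i∈A in k , cong suc eq } }
  where E = enumerate A
enumerate (inside ∷ A) = record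
  { element    = λ { zero → zero ; (suc k) → suc (element E k) }
  ; injective  = λ { {zero} {zero} _ → refl
                   ; {suc k} {suc l} eq → cong suc (injective E (suc-injective eq)) }
  ; member     = λ { zero → here ; (suc k) → there (member E k) }
  ; exhaustive = λ { here → zero , refl
                   ; (there i∈A) → let k , eq = exhaustive E i∈A in suc k , cong suc eq } }
  where E = enumerate A

x∈p⇒1≤∣p∣ : ∀ {n} {p : Subset n} {x} → x ∈ p → 1 ℕ.≤ ∣ p ∣
x∈p⇒1≤∣p∣ x∈p = ℕₚ.≤-trans (s≤s z≤n) (x∈p⇒∣p-x∣<∣p∣ x∈p)

∣p∣≡1⇒singleton : ∀ {n} {p : Subset n} → ∣ p ∣ ≡ 1 → ∃[ x ] ∀ {y} → y ∈ p → y ≡ x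
∣p∣≡1⇒singleton {p = p} eq = x , λ {y} y∈p → decidable-stable (y ≟ x) λ y≢x →
  ℕₚ.<⇒≱ (subst (∣ p - x ∣ ℕ.<_) eq (x∈p⇒∣p-x∣<∣p∣ (member E k))) (x∈p⇒1≤∣p∣ (x∈p∧x≢y⇒x∈p-y y∈p y≢x))
  where
  E = enumerate p
  k = subst Fin (sym eq) zero
  x = element E k

injective⇒surjective : ∀ {n} (f : Fin n → Fin n) → Injective _≡_ _≡_ f → ∀ y → ∃[ x ] f x ≡ y
injective⇒surjective {suc n} f inj y with any? (λ x → f x ≟ y)
... | yes p = p
... | no ∄x = contradiction
  (injective⇒≤ {f = λ x → punchOut (y≢f x)} λ {x} {z} eq → inj (punchOut-injective (y≢f x) (y≢f z) eq))
  ℕₚ.1+n≰n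
  where
  y≢f : ∀ x → y ≢ f x
  y≢f x y≡fx = ∄x (x , sym y≡fx)

-- Parts are unordered, so labellings are compared through the equivalence relations that they
-- induce on the points satisfying `T`.
SameKernelOn : ∀ {n r} → (Fin n → Set) → (f g : Fin n → Fin r) → Set
SameKernelOn T f g = ∀ {t u} → T t → T u → f t ≡ f u ⇔ g t ≡ g u

SameKernel : ∀ {n r} → (f g : Fin n → Fin r) → Set
SameKernel f g = ∀ t u → f t ≡ f u ⇔ g t ≡ g u

sameKernel-extend : ∀ {n r} (f g : Fin n → Fin r) s → SameKernelOn (_≢ s) f g →
  (∀ {u} → u ≢ s → f s ≡ f u ⇔ g s ≡ g u) → SameKernel f g
sameKernel-extend f g s h hₛ t u with t ≟ s | u ≟ s
... | yes refl | yes refl = mk⇔ (λ _ → refl) (λ _ → refl)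
... | yes refl | no u≢s   = hₛ u≢s
... | no t≢s   | yes refl = mk⇔ (sym ∘ to (hₛ t≢s) ∘ sym) (sym ∘ from (hₛ t≢s) ∘ sym)
... | no t≢s   | no u≢s   = h t≢s u≢s

open Partition
open Labelling

module _ {n r} (P Q : Partition n r) where

  -- The common element `t` matches label `i` of `P` with label `j` of `Q`.
  part⊆part : ∀ {i j T} → SameKernelOn T (label P) (label Q) →
    ∀ {t u} → T t → T u → t ∈ part P i → t ∈ part Q j → u ∈ part P i → u ∈ part Q j
  part⊆part {j = j} h {t} {u} Tt Tu t∈P t∈Q u∈P = subst (λ l → u ∈ part Q l)
    (trans (sym (to (h Tt Tu) (trans (label-unique P t∈P) (sym (label-unique P u∈P)))))
      (label-unique Q t∈Q))
    (∈-label Q u)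

module _ {n r} {P Q : Partition n r} where

  sameKernel⇒≋ : SameKernel (label P) (label Q) → P ≋ Q
  sameKernel⇒≋ h A = mk⇔ (transport P Q h) (transport Q P λ t u → ⇔.sym (h t u))
    where
    transport : ∀ P Q → SameKernel (label P) (label Q) → ∀ {A} → A IsPartOf P → A IsPartOf Q
    transport P Q h (j , refl) = let t , t∈ = nonempty P j in label Q t , ⊆-antisym
      (part⊆part Q P {T = λ _ → Unit} (λ {t} {u} _ _ → ⇔.sym (h t u)) tt tt (∈-label Q t) t∈)
      (part⊆part P Q {T = λ _ → Unit} (λ {t} {u} _ _ → h t u) tt tt t∈ (∈-label Q t))

  sameKernel⇒coincide : ∀ {T} → SameKernelOn (_∈ T) (label P) (label Q) → CoincideOn T P Q
  sameKernel⇒coincide {T} h A = mk⇔ (transport P Q h) (transport Q P λ t∈ u∈ → ⇔.sym (h t∈ u∈))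
    where
    transport : ∀ P Q → SameKernelOn (_∈ T) (label P) (label Q) → ∀ {A} → A IsPartOf P ↾ T → A IsPartOf Q ↾ T
    transport P Q h ((t , t∈A) , j , refl) =
      let t∈P , t∈T = x∈p∩q⁻ (part P j) T t∈A
          t∈Q       = ∈-label Q t
      in (t , t∈A) , label Q t , ⊆-antisym
        (λ u∈ → let u∈Q , u∈T = x∈p∩q⁻ (part Q (label Q t)) T u∈ in
          x∈p∩q⁺ (part⊆part Q P {T = _∈ T} (λ t∈ u∈ → ⇔.sym (h t∈ u∈)) t∈T u∈T t∈Q t∈P u∈Q , u∈T))
        (λ u∈ → let u∈P , u∈T = x∈p∩q⁻ (part P j) T u∈ in
          x∈p∩q⁺ (part⊆part P Q {T = _∈ T} h t∈T u∈T t∈P t∈Q u∈P , u∈T))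

  coincide⇒sameKernel : ∀ {T} → CoincideOn T P Q → SameKernelOn (_∈ T) (label P) (label Q)
  coincide⇒sameKernel {T} c {t} {u} t∈T u∈T = mk⇔
    (transport P Q (λ A → to (c A)) t∈T u∈T) (transport Q P (λ A → from (c A)) t∈T u∈T)
    where
    transport : ∀ P Q → (∀ A → A IsPartOf P ↾ T → A IsPartOf Q ↾ T) →
      ∀ {t u} → t ∈ T → u ∈ T → label P t ≡ label P u → label Q t ≡ label Q u
    transport P Q f {t} {u} t∈T u∈T eq =
      let A         = part P (label P t) ∩ T
          t∈A       = x∈p∩q⁺ (∈-label P t , t∈T)
          u∈A       = x∈p∩q⁺ (subst (λ l → u ∈ part P l) (sym eq) (∈-label P u) , u∈T)
          _ , j , e = f A ((t , t∈A) , label P t , refl)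
          in-Q      = λ {x} (x∈A : x ∈ A) → label-unique Q (proj₁ (x∈p∩q⁻ (part Q j) T (subst (x ∈_) (sym e) x∈A)))
      in trans (in-Q t∈A) (sym (in-Q u∈A))

  ≋⇒sameKernel : P ≋ Q → SameKernel (label P) (label Q)
  ≋⇒sameKernel P≋Q t u = coincide⇒sameKernel (≋⇒CoincideOn ⊤ {P} {Q} P≋Q) {t} {u} ∈⊤ ∈⊤

fromLabelling : ∀ {n r} (f : Fin n → Fin r) → (∀ j → ∃[ t ] f t ≡ j) → Partition n r
fromLabelling f onto = record
  { part     = λ j → select (λ t → f t ≟ j)
  ; nonempty = λ j → let t , ft≡j = onto j in t , ∈-select⁺ (λ t → f t ≟ j) ft≡j
  ; disjoint = λ {i} {j} i≢j (t , t∈) →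
      let t∈i , t∈j = x∈p∩q⁻ (select (λ t → f t ≟ i)) (select (λ t → f t ≟ j)) t∈
      in i≢j (trans (sym (∈-select⁻ (λ t → f t ≟ i) t∈i)) (∈-select⁻ (λ t → f t ≟ j) t∈j))
  ; covers   = λ t → f t , ∈-select⁺ (λ u → f u ≟ f t) refl }

-- A companion keeps the part of `s` nonempty after `s` has left, so that the number of parts is
-- preserved.
Companion : ∀ {n r} → Partition n r → Fin n → Set
Companion P s = ∃[ t ] t ≢ s × label P t ≡ label P s

companion? : ∀ {n r} (P : Partition n r) s → Dec (Companion P s)
companion? P s = any? λ t → ¬? (t ≟ s) ×-dec (label P t ≟ label P s)

module _ {n r} (P : Partition n r) {s} (c : Companion P s) where

  -- Representatives that avoid `s` keep their labels when `s` moves.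
  representative : ∀ j → ∃[ t ] t ≢ s × label P t ≡ j
  representative j with label P s ≟ j | nonempty P j
  ... | yes refl | _       = c
  ... | no s∉j   | t , t∈j = t , (λ { refl → s∉j (label-unique P t∈j) }) , label-unique P t∈j

-- Representatives of the parts of `P` that avoid `s` have distinct labels in `Q`. By counting they
-- exhaust all labels, including that of `s`.
companion-transfer : ∀ {n r} (P Q : Partition n r) {s} →
  SameKernelOn (_≢ s) (label P) (label Q) → Companion P s → Companion Q s
companion-transfer {r = r} P Q {s} h c = let j , eq = injective⇒surjective σ σ-injective (label Q s) in
  rep j , rep≢s j , eq
  where
  rep   = λ j → proj₁ (representative P c j)
  rep≢s = λ j → proj₁ (proj₂ (representative P c j))
  rep∈  = λ j → proj₂ (proj₂ (representative P c j))
  σ : Fin r → Fin r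
  σ j = label Q (rep j)
  σ-injective : Injective _≡_ _≡_ σ
  σ-injective {i} {j} eq = trans (sym (rep∈ i)) (trans (from (h (rep≢s i) (rep≢s j)) eq) (rep∈ j))

-- Moving one point to another part

relabel : ∀ {n r} → (Fin n → Fin r) → Fin n → Fin r → Fin n → Fin r
relabel f s j t = if does (t ≟ s) then j else f t

relabel-≡ : ∀ {n r} (f : Fin n → Fin r) s j → relabel f s j s ≡ j
relabel-≡ f s j rewrite dec-true (s ≟ s) refl = refl

relabel-≢ : ∀ {n r} (f : Fin n → Fin r) s j {t} → t ≢ s → relabel f s j t ≡ f t
relabel-≢ f s j {t} t≢s rewrite dec-false (t ≟ s) t≢s = refl

relabel-sameKernel : ∀ {n r} (f : Fin n → Fin r) s j → SameKernelOn (_≢ s) f (relabel f s j)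
relabel-sameKernel f s j t≢s u≢s rewrite relabel-≢ f s j t≢s | relabel-≢ f s j u≢s = ⇔.refl

move : ∀ {n r} (P : Partition n r) {s} → Companion P s → Fin r → Partition n r
move P {s} c j = fromLabelling (relabel (label P) s j) λ l →
  let t , t≢s , t∈l = representative P c l in t , trans (relabel-≢ (label P) s j t≢s) t∈l

module _ {n r} (P : Partition n r) where

  move-distance : ∀ {s} (c : Companion P s) {j} → j ≢ label P s → D[ P , move P c j ]≡ 1
  move-distance {s} c@(a , a≢s , a~s) {j} j≢ =
      (⁅ s ⁆ , ∣⁅x⁆∣≡1 s , sameKernel⇒coincide {P = P} {Q} λ t∈ u∈ →
        relabel-sameKernel (label P) s j (∈∁⇒≢ t∈) (∈∁⇒≢ u∈))
    , λ R coincide → least R coincide (nonempty? R)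
    where
    Q = move P c j
    ∈∁⇒≢ : ∀ {t} → t ∈ ∁ ⁅ s ⁆ → t ≢ s
    ∈∁⇒≢ t∈ refl = x∈∁p⇒x∉p t∈ (x∈⁅x⁆ s)
    least : ∀ R → CoincideOn (∁ R) P Q → Dec (Nonempty R) → 1 ℕ.≤ ∣ R ∣
    least R _ (yes (_ , x∈R)) = x∈p⇒1≤∣p∣ x∈R
    -- With nothing removed, the companion `a` separates the two partitions: it shares the part of
    -- `s` before the move but not after.
    least R coincide (no R-empty) = contradiction
      (trans (sym (relabel-≡ (label P) s j))
        (trans (to (coincide⇒sameKernel {P = P} {Q} coincide (∈∁R s) (∈∁R a)) (sym a~s))
          (trans (relabel-≢ (label P) s j a≢s) a~s)))
      j≢
      where
      ∈∁R : ∀ t → t ∈ ∁ R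
      ∈∁R t = x∉p⇒x∈∁p λ t∈R → R-empty (t , t∈R)

  -- The first move takes `s` away from its companion `a` and joins it to a point `b` of part `j`. A
  -- second move of another point with the same result would have to move `a`, and then `s` and `b`
  -- would remain apart. Once `s` is known, `b` also determines the destination.
  move-injective : ∀ {s s′} (c : Companion P s) (c′ : Companion P s′) {j j′} →
    j ≢ label P s → j′ ≢ label P s′ → move P c j ≋ move P c′ j′ → s ≡ s′ × j ≡ j′
  move-injective {s} {s′} c@(a , a≢s , a~s) c′ {j} {j′} j≢ j′≢ eq = s≡s′ , j≡j′
    where
    f  = relabel (label P) s j
    f′ = relabel (label P) s′ j′
    h : SameKernel f f′
    h = ≋⇒sameKernel {P = move P c j} {move P c′ j′} eq
    b = proj₁ (representative P c j)
    b≢s = proj₁ (proj₂ (representative P c j))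
    b∈j = proj₂ (proj₂ (representative P c j))
    fs≡fb : f s ≡ f b
    fs≡fb = trans (relabel-≡ (label P) s j) (sym (trans (relabel-≢ (label P) s j b≢s) b∈j))
    f′s≡f′b : f′ s ≡ f′ b
    f′s≡f′b = to (h s b) fs≡fb
    s≡s′ : s ≡ s′
    s≡s′ = decidable-stable (s ≟ s′) λ s≢s′ →
      let f′s : f′ s ≡ label P s
          f′s = relabel-≢ (label P) s′ j′ s≢s′
          a≡s′ : a ≡ s′
          a≡s′ = decidable-stable (a ≟ s′) λ a≢s′ → j≢
            (trans (sym (relabel-≡ (label P) s j))
              (trans (from (h s a) (trans f′s (trans (sym a~s) (sym (relabel-≢ (label P) s′ j′ a≢s′)))))
                (trans (relabel-≢ (label P) s j a≢s) a~s)))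
          b≢s′ : b ≢ s′
          b≢s′ b≡s′ = j≢ (trans (sym b∈j) (trans (cong (label P) (trans b≡s′ (sym a≡s′))) a~s))
      in j≢ (trans (sym b∈j) (trans (sym (relabel-≢ (label P) s′ j′ b≢s′)) (trans (sym f′s≡f′b) f′s)))
    j≡j′ : j ≡ j′
    j≡j′ = trans (sym b∈j) (trans (sym (relabel-≢ (label P) s′ j′ (subst (b ≢_) s≡s′ b≢s)))
      (trans (sym f′s≡f′b) (trans (cong f′ s≡s′) (relabel-≡ (label P) s′ j′))))

  -- The partitions agree away from the single element `s` of `R`. If `s` were alone in `P`, it
  -- would be alone in `Q` by `companion-transfer`, and the partitions would be equal. Otherwise a
  -- companion `t` of `s` in `Q` gives the destination `label P t`.
  move-complete : ∀ Q → D[ P , Q ]≡ 1 →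
    ∃[ s ] Σ (Companion P s) λ c → ∃[ j ] j ≢ label P s × move P c j ≋ Q
  move-complete Q d@((R , ∣R∣≡1 , coincide) , _) = s , classify (companion? P s)
    where
    s = proj₁ (∣p∣≡1⇒singleton {p = R} ∣R∣≡1)
    h : SameKernelOn (_≢ s) (label P) (label Q)
    h t≢s u≢s = coincide⇒sameKernel {P = P} {Q} coincide (≢⇒∈∁ t≢s) (≢⇒∈∁ u≢s)
      where
      ≢⇒∈∁ : ∀ {t} → t ≢ s → t ∈ ∁ R
      ≢⇒∈∁ t≢s = x∉p⇒x∈∁p (t≢s ∘ proj₂ (∣p∣≡1⇒singleton {p = R} ∣R∣≡1))
    different : ¬ SameKernel (label P) (label Q)
    different k = D-irrefl P Q (sameKernel⇒≋ {P = P} {Q} k) d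
    classify : Dec (Companion P s) → Σ (Companion P s) λ c → ∃[ j ] j ≢ label P s × move P c j ≋ Q
    classify (no alone) = contradiction (sameKernel-extend (label P) (label Q) s h λ u≢s → mk⇔
      (λ eq → contradiction (_ , u≢s , sym eq) alone)
      (λ eq → contradiction (companion-transfer Q P (λ t≢s u≢s → ⇔.sym (h t≢s u≢s)) (_ , u≢s , sym eq)) alone))
      different
    classify (yes c) = c , label P t , t≁s , sameKernel⇒≋ {P = move P c (label P t)} {Q}
      (sameKernel-extend f (label Q) s
        (λ t≢s u≢s → ⇔.trans (⇔.sym (relabel-sameKernel (label P) s (label P t) t≢s u≢s)) (h t≢s u≢s))
        λ u≢s → mk⇔
          (λ eq → trans (sym t~s) (to (h t≢s u≢s)
            (trans (sym fs) (trans eq (relabel-≢ (label P) s _ u≢s)))))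
          (λ eq → trans fs (trans (from (h t≢s u≢s) (trans t~s eq))
            (sym (relabel-≢ (label P) s _ u≢s)))))
      where
      c′  = companion-transfer P Q h c
      t   = proj₁ c′
      t≢s = proj₁ (proj₂ c′)
      t~s = proj₂ (proj₂ c′)
      f   = relabel (label P) s (label P t)
      fs : f s ≡ label P t
      fs = relabel-≡ (label P) s (label P t)
      t≁s : label P t ≢ label P s
      t≁s t≡s = different (sameKernel-extend (label P) (label Q) s h λ u≢s → mk⇔
        (λ eq → trans (sym t~s) (to (h t≢s u≢s) (trans t≡s eq)))
        (λ eq → trans (sym t≡s) (from (h t≢s u≢s) (trans t~s eq))))

-- The degree of a Tverberg partition

IsTverberg-resp-≋ : ∀ {d n r} (S : PointSet d n) {P Q : Partition n r} →
  P ≋ Q → IsTverberg S P → IsTverberg S Q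
IsTverberg-resp-≋ S {P} {Q} P≋Q (y , y∈) = y , λ j →
  let l , eq = Equivalence.from (P≋Q (part Q j)) (j , refl)
  in subst (y ∈conv[ S ]_) eq (y∈ l)

module Degree (em : ExcludedMiddle 0ℓ) {d n r} (S : PointSet d n)
  (P : Partition n (suc r)) (P-tverberg : IsTverberg S P) where

  open Graph G-T[ S , suc r ]
  open WithEM em
  open Weights em S P

  destination : Fin n → Fin r → Fin (suc r)
  destination s = punchIn (label P s)

  destination-≢ : ∀ s k → destination s k ≢ label P s
  destination-≢ s k = punchInᵢ≢i (label P s) k

  Legal : Fin n × Fin r → Set
  Legal (s , k) = Σ (Companion P s) λ c → IsTverberg S (move P c (destination s k))

  legal? : ∀ t → Dec (Legal (remQuot r t))
  legal? t = em

  -- Coding a move by a single element of `Fin (n * r)` makes the degree the size of a subset, from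
  -- which the upper bound is immediate.
  legal : Subset (n * r)
  legal = select legal?

  degree : ℕ
  degree = ∣ legal ∣

  E = enumerate legal

  source : Fin degree → Fin n × Fin r
  source i = remQuot r (element E i)

  source-legal : ∀ i → Legal (source i)
  source-legal i = ∈-select⁻ legal? (member E i)

  source-injective : Injective _≡_ _≡_ source
  source-injective {i} {j} eq = injective E
    (trans (sym (combine-remQuot {n} r (element E i)))
      (trans (cong (uncurry combine) eq) (combine-remQuot {n} r (element E j))))

  source-onto : ∀ {m} → Legal m → ∃[ i ] source i ≡ m
  source-onto {s , k} l =
    let i , eq = exhaustive E (∈-select⁺ legal? {combine s k} (subst Legal (sym (remQuot-combine s k)) l))
    in i , trans (cong (remQuot r) eq) (remQuot-combine s k)

  moved : ∀ {m} → Legal m → Partition n (suc r)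
  moved {s , k} (c , _) = move P c (destination s k)

  neighbour : ∀ {m} → Legal m → Σ Vertex ((P , P-tverberg) ~_)
  neighbour {s , k} l@(c , tv) = (moved l , tv) , move-distance P c (destination-≢ s k)

  -- The two proofs may name different companions, but the labelling after the move does not depend
  -- on them.
  moved-cong : ∀ {m m′} (l : Legal m) (l′ : Legal m′) → m ≡ m′ → moved l ≋ moved l′
  moved-cong l l′ refl = sameKernel⇒≋ {P = moved l} {moved l′} λ _ _ → ⇔.refl

  moved-injective : ∀ {m m′} (l : Legal m) (l′ : Legal m′) → moved l ≋ moved l′ → m ≡ m′
  moved-injective {s , k} {s′ , k′} (c , _) (c′ , _) eq
    with move-injective P c c′ (destination-≢ s k) (destination-≢ s′ k′) eq
  ... | refl , j≡j′ = cong (s ,_) (punchIn-injective (label P s) k k′ j≡j′)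

  moved-onto : ∀ ((Q , _) : Σ Vertex ((P , P-tverberg) ~_)) → ∃[ m ] Σ (Legal m) λ l → moved l ≋ proj₁ Q
  moved-onto ((Q , Q-tverberg) , PQ) =
    let s , c , j , j≢ , eq = move-complete P Q PQ
        k = punchOut (j≢ ∘ sym)
        j≡ = punchIn-punchOut (j≢ ∘ sym)
        eq′ = subst (λ j → move P c j ≋ Q) (sym j≡) eq
    in (s , k) , (c , IsTverberg-resp-≋ S {Q} {move P c (destination s k)} (λ A → ⇔.sym (eq′ A)) Q-tverberg) , eq′

  hasDegree : HasDegree (P , P-tverberg) degree
  hasDegree = record
    { to   = λ i → neighbour (source-legal i)
    ; cong = λ { {i} refl A → ⇔.refl }
    ; bijective =
        (λ {i} {j} eq → source-injective (moved-injective (source-legal i) (source-legal j) eq))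
      , λ Q → let m , l , eq = moved-onto Q
                  i , i↦m = source-onto l
              in i , λ { refl A → ⇔.trans (moved-cong (source-legal i) l i↦m A) (eq A) } }

  -- The two degree bounds

  degree≤ : degree ≤ n * r
  degree≤ = ∣p∣≤n legal

  -- Only `s` changes its part, and it carries no weight, so `centre W` remains in every convex
  -- hull. The positive weight in the part of `s` sits at another point, which is the companion.
  redundant⇒legal : ∀ {s} → Redundant matrix s → ∀ k → Legal (s , k)
  redundant⇒legal {s} (w , W , wₛ≃0) k = c , centre W , λ l → centre-∈conv W l λ {i} i∈l i∉ →
    subst (λ i → w i ≃ 0ℝ) (sym (decidable-stable (i ≟ s) λ i≢s → i∉ (stays i∈l i≢s))) wₛ≃0
    where
    a = positive-in W (label P s)
    c : Companion P s
    c = proj₁ a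
      , (λ a≡s → Pos⇒≄0 (proj₂ (proj₂ a)) (subst (λ i → w i ≃ 0ℝ) (sym a≡s) wₛ≃0))
      , label-unique P (proj₁ (proj₂ a))
    stays : ∀ {i l} → i ∈ part P l → i ≢ s → i ∈ part (move P c (destination s k)) l
    stays {i} {l} i∈l i≢s = ∈-select⁺ (λ t → relabel (label P) s (destination s k) t ≟ l)
      (trans (relabel-≢ (label P) s (destination s k) i≢s) (label-unique P i∈l))

  essential? : ∀ s → Dec (¬ Redundant matrix s)
  essential? s = em

  essential : Subset n
  essential = select essential?

  essential-bound : suc (suc d * r) < n → ∣ essential ∣ ≤ suc d * r
  essential-bound 1+m<n = non-redundant-bound matrix 1+m<n (proj₂ (solution P-tverberg)) essential (∈-select⁻ essential?)

  ∉essential⇒redundant : ∀ {s} → s ∈ ∁ essential → Redundant matrix s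
  ∉essential⇒redundant s∈ = decidable-stable em λ ¬red → x∈∁p⇒x∉p s∈ (∈-select⁺ essential? ¬red)

  redundant-moves≤degree : ∣ ∁ essential ∣ * r ≤ degree
  redundant-moves≤degree = injective⇒≤ {f = f} λ {x} {y} eq → source⁻-injective x y (cong source eq)
    where
    F = enumerate (∁ essential)
    m : Fin (∣ ∁ essential ∣ * r) → Fin n × Fin r
    m t = let a , k = remQuot r t in element F a , k
    m-legal : ∀ t → Legal (m t)
    m-legal t = redundant⇒legal (∉essential⇒redundant (member F (proj₁ (remQuot {∣ ∁ essential ∣} r t)))) (proj₂ (remQuot {∣ ∁ essential ∣} r t))
    f : Fin (∣ ∁ essential ∣ * r) → Fin degree
    f t = proj₁ (source-onto (m-legal t))
    m-injective : ∀ x y → m x ≡ m y → x ≡ y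
    m-injective x y eq = trans (sym (combine-remQuot {∣ ∁ essential ∣} r x))
      (trans (cong₂ combine (injective F (cong proj₁ eq)) (cong proj₂ eq)) (combine-remQuot {∣ ∁ essential ∣} r y))
    source⁻-injective : ∀ x y → source (f x) ≡ source (f y) → x ≡ y
    source⁻-injective x y eq = m-injective x y
      (trans (sym (proj₂ (source-onto (m-legal x)))) (trans eq (proj₂ (source-onto (m-legal y)))))

  degree≥ : Tv d (suc r) < n → ((n + 1) ∸ Tv d (suc r)) * r ≤ degree
  degree≥ Tv<n = begin
    -- Since `Tv d (suc r)` is one more than the number of rows, both arguments of the subtraction
    -- become successors, and these cancel by computation.
    ((n + 1) ∸ ((d + 1) * r + 1)) * r ≡⟨ cong (_* r) (cong₂ _∸_ (ℕₚ.+-comm n 1) Tv≡) ⟩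
    (n ∸ suc d * r) * r               ≤⟨ ℕₚ.*-monoˡ-≤ r (ℕₚ.∸-monoʳ-≤ n (essential-bound (subst (_< n) Tv≡ Tv<n))) ⟩
    (n ∸ ∣ essential ∣) * r           ≡⟨ cong (_* r) (∣∁p∣≡n∸∣p∣ essential) ⟨
    ∣ ∁ essential ∣ * r               ≤⟨ redundant-moves≤degree ⟩
    degree ∎
    where
    open ℕₚ.≤-Reasoning
    Tv≡ : Tv d (suc r) ≡ suc (suc d * r)
    Tv≡ = trans (ℕₚ.+-comm ((d + 1) * r) 1) (cong (λ e → suc (e * r)) (ℕₚ.+-comm d 1))

theorem1p5 : ExcludedMiddle 0ℓ →
    (d r n : ℕ) → 0 < d → 0 < r → Tv d r < n →
    (S : PointSet d n) (v : Graph.Vertex G-T[ S , r ]) →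
    ∃[ k ] Graph.HasDegree G-T[ S , r ] v k
    × ((n + 1) ∸ Tv d r) * (r ∸ 1) ≤ k
    × k ≤ n * (r ∸ 1)
theorem1p5 em d (suc r) n _ _ Tv<n S (P , P-tverberg) = degree , hasDegree , degree≥ Tv<n , degree≤
  where open Degree em S P P-tverberg
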